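{- There is an absolute constant $C>0$ such that for any edge-ordered graph $H$ on $n\ge 2$ vertices, $r_{\text{edge, ind}}(H)\le 2^{Cn^2(\log_2 n)^2}$.
   Context: An edge-ordered graph is a finite simple graph (not necessarily complete) together with a total ordering of its edges. Two edge-ordered graphs are equivalent if there is a graph isomorphism between them preserving the ordering of the edges. A monochromatic induced copy of $H$ in an edge-colored edge-ordered graph $G$ is an induced subgraph of $G$ (with inherited edge-ordering) equivalent to $H$ all of whose edges have the same color. The edge-induced Ramsey number $r_{\text{edge, ind}}(H)$ is the smallest $N$ such that there exists an edge-ordered graph $G$ on $N$ vertices such that every two-coloring of the edges of $G$ contains a monochromatic induced copy of $H$. -}

module Defs where

open import Data.Nat using (ℕ; _<_; _≤_; _*_; _^_)
open import Data.Nat.Logarithm using (⌊log₂_⌋)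
open import Data.Fin using (Fin)
open import Data.Bool using (Bool; true; false)
open import Data.Product using (Σ; ∃; _×_; _,_)
open import Data.Sum using (_⊎_)
open import Function.Bundles using (_⇔_)
open import Function.Definitions using (Injective)
open import Relation.Binary.PropositionalEquality using (_≡_; _≢_)

-- An edge-ordered graph on vertex set Fin n: a finite simple graph
-- (symmetric, irreflexive adjacency) together with a total order on its
-- edges, given by a rank function on edges that is injective on edges
-- (the edge {u,v} comes before {x,y} iff rank u v < rank x y).
record EOGraph (n : ℕ) : Set where
  field
    adj      : Fin n → Fin n → Bool
    adj-sym  : ∀ u v → adj u v ≡ adj v u
    adj-irr  : ∀ u → adj u u ≡ false
    rank     : Fin n → Fin n → ℕ
    rank-sym : ∀ u v → rank u v ≡ rank v u
    rank-inj : ∀ a b c d → adj a b ≡ true → adj c d ≡ true →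
               rank a b ≡ rank c d → (a ≡ c × b ≡ d) ⊎ (a ≡ d × b ≡ c)

open EOGraph public

record Colouring {N : ℕ} (G : EOGraph N) : Set where
  field
    col     : Fin N → Fin N → Bool
    col-sym : ∀ u v → col u v ≡ col v u

open Colouring public

record InducedOrderedEmbedding {m N : ℕ} (H : EOGraph m) (G : EOGraph N)
       (f : Fin m → Fin N) : Set where
  field
    inj      : Injective _≡_ _≡_ f
    adj-pres : ∀ a b → adj G (f a) (f b) ≡ adj H a b
    ord-pres : ∀ a b c d → adj H a b ≡ true → adj H c d ≡ true →
               (rank H a b < rank H c d) ⇔ (rank G (f a) (f b) < rank G (f c) (f d))

MonoInducedCopy : {m N : ℕ} (H : EOGraph m) (G : EOGraph N) → Colouring G → Set
MonoInducedCopy {m} {N} H G c =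
  Σ (Fin m → Fin N) λ f → InducedOrderedEmbedding H G f ×
    Σ Bool λ colour → ∀ a b → adj H a b ≡ true → col c (f a) (f b) ≡ colour

Arrows : {m N : ℕ} → EOGraph N → EOGraph m → Set
Arrows G H = ∀ (c : Colouring G) → MonoInducedCopy H G c

EdgeIndRamseyLE : {m : ℕ} → EOGraph m → ℕ → Set
EdgeIndRamseyLE H M = Σ ℕ λ N → N ≤ M × Σ (EOGraph N) λ G → Arrows G H

{-# OPTIONS --safe #-}
-- The vertices of G carry a Toeplitz hash, and pairs get one of K = 2^O(n log n) ordered labels so that, for each label,
-- almost every vertex has about |S|/K neighbours with that label in any given large set S; the edge order of G refines the label order.
-- Fix a colouring and an interval of labels, divided into many subintervals. A greedy embedding of H, whose i-th edge takes a
-- red label from the i-th subinterval, either succeeds or finds large sets A and B between which one subinterval has almost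
-- no red. Continuing inside A and then inside B with ever smaller intervals gives, at depth ⌈log n⌉, at least n large sets and an
-- interval of labels that is almost free of red between any two of them, and in these sets H is embedded in blue.
-- There are O(log n) levels, each shrinking the sets by 2^O(n² log n), whence the exponent O(n² log² n).
module Submission where

open import Defs
open import Data.Bool using (Bool; true; false; _∧_; _∨_; not; _xor_; if_then_else_)
import Data.Bool.Properties as 𝔹
open import Data.Bool.Solver using (module xor-∧-Solver)
open import Data.Empty using (⊥-elim)
open import Data.Fin as 𝔽 using (Fin; zero; suc; toℕ; fromℕ<; combine; remQuot; _↑ˡ_; _↑ʳ_)
open import Data.Fin.Properties as 𝔽 using (any?; all?; ¬∀⟶∃¬)
open import Data.List using (List; []; _∷_; _++_; length; lookup)
open import Data.List.Properties using (length-++)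
open import Data.List.Relation.Unary.All as All using (All; []; _∷_)
import Data.List.Relation.Unary.All.Properties as All
open import Data.List.Relation.Unary.AllPairs as AllPairs using (AllPairs; []; _∷_)
import Data.List.Relation.Unary.AllPairs.Properties as AllPairs
open import Data.Nat
open import Data.Nat.Induction using (<-rec)
open import Data.Nat.Logarithm using (⌊log₂_⌋; ⌊log₂⌋-mono-≤; ⌊log₂[2^n]⌋≡n; ⌊log₂⌊n/2⌋⌋≡⌊log₂n⌋∸1)
open import Data.Nat.Properties
open import Data.Nat.Tactic.RingSolver using (solve-∀)
open import Data.Product using (Σ; ∃; ∃₂; _×_; _,_; proj₁; proj₂)
open import Data.Sum as Sum using (_⊎_; inj₁; inj₂)
open import Data.Vec using (Vec; []; _∷_; replicate; zipWith)
open import Data.Vec.Properties using (zipWith-comm; ∷-injective)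
open import Function using (_∘_; mk⇔)
open import Relation.Binary.Definitions using (tri<; tri≈; tri>)
open import Relation.Binary.PropositionalEquality
open import Relation.Nullary using (¬_; Dec; yes; no; does; _×-dec_)
open import Algebra.Properties.CommutativeSemigroup *-commutativeSemigroup using (x∙yz≈y∙xz)
open import Algebra.Properties.Semiring.Sum +-*-semiring
  using (sum; ∑-comm; ∑-distrib-+; sum-cong-≗; *-distribˡ-sum; *-distribʳ-sum)

-- The exponent depends on two losses being paid differently. All `2 ^ g - 1` red steps of the
-- recursion use one nested chain of label intervals, each step costing a factor `M` of order n², so
-- that K = M^(2^g) = 2^O(n log n). The vertex sets lose only along a branch, which has O(log n)
-- steps. The red density that the blue embedding tolerates fixes the price of a red step. If that
-- density grew by a factor K with each embedded vertex, it would have to start near K^(-n), and a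
-- red step would cost 2^O(n³ log n) instead of 2^O(n² log n). The Toeplitz form keeps N small. A
-- seed for hashing D bits to k bits has only D + k bits, so N = 2^(2D + 2k), and the second moment
-- controls all sets larger than N^(3/4) times a power of K; the sets may thus shrink by about
-- 2^(D/2). With a full random matrix as the seed, of D k bits, the permitted shrinkage would still
-- be 2^O(D), but N would be about 2^(D k), with an exponent of order n³ log³ n.

private variable
  N n : ℕ

-- Counting subsets of Fin N

does⇒ : ∀ {P : Set} (d : Dec P) → does d ≡ true → P
does⇒ (yes p) _ = p

¬does⇒ : ∀ {P : Set} (d : Dec P) → does d ≡ false → ¬ P
¬does⇒ (no ¬p) _ = ¬p

⇒does : ∀ {P : Set} (d : Dec P) → P → does d ≡ true
⇒does (yes _) _ = refl
⇒does (no ¬p) p = ⊥-elim (¬p p)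

∧-intro : ∀ {a b} → a ≡ true → b ≡ true → a ∧ b ≡ true
∧-intro refl refl = refl

∧-elimˡ : ∀ {a b} → a ∧ b ≡ true → a ≡ true
∧-elimˡ {true} _ = refl

∧-elimʳ : ∀ {a b} → a ∧ b ≡ true → b ≡ true
∧-elimʳ {true} p = p

opaque
  infix 4 _<ᴮ_
  _<ᴮ_ : ℕ → ℕ → Bool
  a <ᴮ b = does (a <? b)

  <ᴮ⇒< : ∀ {a b} → (a <ᴮ b) ≡ true → a < b
  <ᴮ⇒< {a} {b} = does⇒ (a <? b)

  <⇒<ᴮ : ∀ {a b} → a < b → (a <ᴮ b) ≡ true
  <⇒<ᴮ {a} {b} = ⇒does (a <? b)

  ≮ᴮ⇒≥ : ∀ {a b} → (a <ᴮ b) ≡ false → b ≤ a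
  ≮ᴮ⇒≥ {a} {b} p = ≮⇒≥ (¬does⇒ (a <? b) p)

  anyᴮ : ∀ {n} → (Fin n → Bool) → Bool
  anyᴮ p = does (any? (λ i → p i 𝔹.≟ true))

  anyᴮ⇒∃ : ∀ {n} (p : Fin n → Bool) → anyᴮ p ≡ true → ∃ λ i → p i ≡ true
  anyᴮ⇒∃ p = does⇒ (any? (λ i → p i 𝔹.≟ true))

  ¬anyᴮ⇒∀ : ∀ {n} (p : Fin n → Bool) → anyᴮ p ≡ false → ∀ i → p i ≡ false
  ¬anyᴮ⇒∀ p q i = 𝔹.¬-not λ r → ¬does⇒ (any? (λ i → p i 𝔹.≟ true)) q (i , r)

∧-falseʳ : ∀ {a b} → a ≡ true → a ∧ b ≡ false → b ≡ false
∧-falseʳ refl p = p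

false≢true : false ≢ true
false≢true ()

true? : (b : Bool) → b ≡ true ⊎ b ≡ false
true? true  = inj₁ refl
true? false = inj₂ refl

⟦_⟧ : Bool → ℕ
⟦ true ⟧  = 1
⟦ false ⟧ = 0

Sub : ℕ → Set
Sub N = Fin N → Bool

opaque
  # : Sub N → ℕ
  # S = sum (λ i → ⟦ S i ⟧)

  #-sum : (S : Sub N) → # S ≡ sum (λ i → ⟦ S i ⟧)
  #-sum S = refl

infixr 6 _∩_
_∩_ : Sub N → Sub N → Sub N
(A ∩ B) i = A i ∧ B i

infix 4 _⊆_
_⊆_ : Sub N → Sub N → Set
A ⊆ B = ∀ i → A i ≡ true → B i ≡ true

sum-mono : (f g : Fin n → ℕ) → (∀ i → f i ≤ g i) → sum f ≤ sum g
sum-mono {zero}  f g h = z≤n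
sum-mono {suc n} f g h = +-mono-≤ (h zero) (sum-mono (f ∘ suc) (g ∘ suc) (h ∘ suc))

sum-zero : (f : Fin n → ℕ) → (∀ i → f i ≡ 0) → sum f ≡ 0
sum-zero {zero}  f h = refl
sum-zero {suc n} f h = cong₂ _+_ (h zero) (sum-zero (f ∘ suc) (h ∘ suc))

sum-ones : ∀ n → sum {n} (λ _ → 1) ≡ n
sum-ones zero    = refl
sum-ones (suc n) = cong suc (sum-ones n)

sum-const≤ : (f : Fin n → ℕ) (u : ℕ) → (∀ i → f i ≤ u) → sum f ≤ n * u
sum-const≤ {zero}  f u h = z≤n
sum-const≤ {suc n} f u h = +-mono-≤ (h zero) (sum-const≤ (f ∘ suc) u (h ∘ suc))

term≤sum : (f : Fin n → ℕ) (i : Fin n) → f i ≤ sum f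
term≤sum f zero    = m≤m+n _ _
term≤sum f (suc i) = ≤-trans (term≤sum (f ∘ suc) i) (m≤n+m _ _)

⟦⟧-mono : ∀ {a b} → (a ≡ true → b ≡ true) → ⟦ a ⟧ ≤ ⟦ b ⟧
⟦⟧-mono {false}        h = z≤n
⟦⟧-mono {true} {true}  h = ≤-refl
⟦⟧-mono {true} {false} h with () ← h refl

⟦⟧-∧ : ∀ a b → ⟦ a ∧ b ⟧ ≡ ⟦ a ⟧ * ⟦ b ⟧
⟦⟧-∧ true  b = sym (+-identityʳ _)
⟦⟧-∧ false b = refl

opaque
  unfolding #

  #-mono : (A B : Sub N) → A ⊆ B → # A ≤ # B
  #-mono A B h = sum-mono _ _ (λ i → ⟦⟧-mono (h i))

  #-∪ : (S A B : Sub N) → (∀ i → S i ≡ true → A i ≡ true ⊎ B i ≡ true) → # S ≤ # A + # B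
  #-∪ S A B h = ≤-trans (sum-mono _ _ (λ i → pt (S i) (A i) (B i) (h i)))
                        (≤-reflexive (∑-distrib-+ (λ i → ⟦ A i ⟧) (λ i → ⟦ B i ⟧)))
    where
    pt : ∀ s a b → (s ≡ true → a ≡ true ⊎ b ≡ true) → ⟦ s ⟧ ≤ ⟦ a ⟧ + ⟦ b ⟧
    pt false a b h = z≤n
    pt true a b h with h refl
    ... | inj₁ refl = s≤s z≤n
    ... | inj₂ refl = m≤n+m 1 _

  #-⋃ : (S : Sub N) (B : Fin n → Sub N) (w u : ℕ) →
        (∀ x → S x ≡ true → ∃ λ i → B i x ≡ true) →
        (∀ i → # (B i) * w ≤ u) → # S * w ≤ n * u
  #-⋃ {n = n} S B w u cov small = begin
    # S * w                          ≤⟨ *-monoˡ-≤ w (sum-mono _ _ pt) ⟩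
    sum (λ x → sum (λ i → ⟦ B i x ⟧)) * w ≡⟨ cong (_* w) (∑-comm (λ x i → ⟦ B i x ⟧)) ⟩
    sum (λ i → # (B i)) * w          ≡⟨ *-distribʳ-sum w (λ i → # (B i)) ⟩
    sum (λ i → # (B i) * w)          ≤⟨ sum-const≤ _ u small ⟩
    n * u                            ∎
    where
    open ≤-Reasoning
    pt : ∀ x → ⟦ S x ⟧ ≤ sum (λ i → ⟦ B i x ⟧)
    pt x with S x in eq
    ... | false = z≤n
    ... | true with i , p ← cov x eq =
      ≤-trans (≤-reflexive (cong ⟦_⟧ (sym p))) (term≤sum (λ i → ⟦ B i x ⟧) i)

opaque
  -- Union bound, with densities cross-multiplied to stay in ℕ: each bad set meets `W` in at most
  -- `u / w` vertices, and `n` such sets cannot exhaust `W`.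
  avoid : (W : Sub N) (B : Fin n → Sub N) (w u : ℕ) →
          (∀ i → # (W ∩ B i) * w ≤ u) → n * u < # W * w →
          ∃ λ x → W x ≡ true × (∀ i → B i x ≡ false)
  avoid {N} {n} W B w u small big
    with any? (λ x → all? (λ i → B i x 𝔹.≟ false) ×-dec (W x 𝔹.≟ true))
  ... | yes (x , p , q) = x , q , p
  ... | no ¬p = ⊥-elim (<⇒≱ big (#-⋃ W (λ i → W ∩ B i) w u cov small))
    where
    cov : ∀ x → W x ≡ true → ∃ λ i → W x ∧ B i x ≡ true
    cov x wx with i , q ← ¬∀⟶∃¬ n (λ i → B i x ≡ false) (λ i → B i x 𝔹.≟ false) (λ a → ¬p (x , a , wx))
      = i , ∧-intro wx (𝔹.¬-not q)

opaque
  unfolding #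

  double-count : (A B : Sub N) (R : Fin N → Fin N → Bool) →
    sum (λ x → ⟦ A x ⟧ * # (λ y → B y ∧ R x y)) ≡ sum (λ y → ⟦ B y ⟧ * # (λ x → A x ∧ R x y))
  double-count A B R = begin
    sum (λ x → ⟦ A x ⟧ * # (λ y → B y ∧ R x y))
      ≡⟨ sum-cong-≗ (λ x → *-distribˡ-sum ⟦ A x ⟧ (λ y → ⟦ B y ∧ R x y ⟧)) ⟩
    sum (λ x → sum (λ y → ⟦ A x ⟧ * ⟦ B y ∧ R x y ⟧))
      ≡⟨ ∑-comm (λ x y → ⟦ A x ⟧ * ⟦ B y ∧ R x y ⟧) ⟩
    sum (λ y → sum (λ x → ⟦ A x ⟧ * ⟦ B y ∧ R x y ⟧))
      ≡⟨ sum-cong-≗ (λ y → sum-cong-≗ (λ x → pt (A x) (B y) (R x y))) ⟩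
    sum (λ y → sum (λ x → ⟦ B y ⟧ * ⟦ A x ∧ R x y ⟧))
      ≡⟨ sum-cong-≗ (λ y → *-distribˡ-sum ⟦ B y ⟧ (λ x → ⟦ A x ∧ R x y ⟧)) ⟨
    sum (λ y → ⟦ B y ⟧ * # (λ x → A x ∧ R x y)) ∎
    where
    open ≡-Reasoning
    pt : ∀ a b r → ⟦ a ⟧ * ⟦ b ∧ r ⟧ ≡ ⟦ b ⟧ * ⟦ a ∧ r ⟧
    pt true true r = refl
    pt true false r = refl
    pt false true r = refl
    pt false false r = refl

  sum-in : (S : Sub N) (f : Fin N → ℕ) (u : ℕ) → (∀ x → S x ≡ true → f x ≤ u) →
           sum (λ x → ⟦ S x ⟧ * f x) ≤ # S * u
  sum-in S f u h = ≤-trans (sum-mono _ _ pt) (≤-reflexive (sym (*-distribʳ-sum u (λ x → ⟦ S x ⟧))))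
    where
    pt : ∀ x → ⟦ S x ⟧ * f x ≤ ⟦ S x ⟧ * u
    pt x with S x in eq
    ... | true  = *-monoʳ-≤ 1 (h x eq)
    ... | false = z≤n

  sum-in≥ : (S : Sub N) (f : Fin N → ℕ) (u : ℕ) → (∀ x → S x ≡ true → u ≤ f x) →
            # S * u ≤ sum (λ x → ⟦ S x ⟧ * f x)
  sum-in≥ S f u h = ≤-trans (≤-reflexive (*-distribʳ-sum u (λ x → ⟦ S x ⟧))) (sum-mono _ _ pt)
    where
    pt : ∀ x → ⟦ S x ⟧ * u ≤ ⟦ S x ⟧ * f x
    pt x with S x in eq
    ... | true  = *-monoʳ-≤ 1 (h x eq)
    ... | false = z≤n

#-empty : (S : Sub N) → (∀ x → S x ≡ false) → # S ≡ 0
#-empty S h = trans (#-sum S) (sum-zero _ (λ x → cong ⟦_⟧ (h x)))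

not-elim : ∀ {a} → not a ≡ true → a ≡ false
not-elim {false} _ = refl

-- Double count the `R`-pairs between `A` and `B`: seen from `B` there are at most `# B * u / w`,
-- while the members of `A′` alone contribute `# A′ * # B / t`. Then `# B` cancels.
dense-few : (A A′ B : Sub N) (R : Fin N → Fin N → Bool) (w u t : ℕ) → 0 < # B → A′ ⊆ A →
  (∀ y → B y ≡ true → # (λ x → A x ∧ R x y) * w ≤ u) →
  (∀ x → A′ x ≡ true → # B ≤ t * # (λ y → B y ∧ R x y)) →
  # A′ * w ≤ t * u
dense-few A A′ B R w u t B>0 A′⊆A few dense =
  *-cancelˡ-≤ (# B) ⦃ >-nonZero B>0 ⦄ (begin
  # B * (# A′ * w)  ≡⟨ trans (x∙yz≈y∙xz (# B) (# A′) w) (sym (*-assoc (# A′) (# B) w)) ⟩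
  # A′ * # B * w ≤⟨ *-monoˡ-≤ w (sum-in≥ A′ (λ x → t * # (λ y → B y ∧ R x y)) (# B) dense) ⟩
  sum (λ x → ⟦ A′ x ⟧ * (t * # (λ y → B y ∧ R x y))) * w
    ≤⟨ *-monoˡ-≤ w (sum-mono _ _ (λ x → *-monoˡ-≤ _ (⟦⟧-mono (A′⊆A x)))) ⟩
  sum (λ x → ⟦ A x ⟧ * (t * # (λ y → B y ∧ R x y))) * w
    ≡⟨ cong (_* w) (sum-cong-≗ (λ x → x∙yz≈y∙xz ⟦ A x ⟧ t (# (λ y → B y ∧ R x y)))) ⟩
  sum (λ x → t * (⟦ A x ⟧ * # (λ y → B y ∧ R x y))) * w
    ≡⟨ cong (_* w) (*-distribˡ-sum t (λ x → ⟦ A x ⟧ * # (λ y → B y ∧ R x y))) ⟨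
  t * sum (λ x → ⟦ A x ⟧ * # (λ y → B y ∧ R x y)) * w
    ≡⟨ cong (λ z → t * z * w) (double-count A B R) ⟩
  t * sum (λ y → ⟦ B y ⟧ * # (λ x → A x ∧ R x y)) * w
    ≡⟨ *-assoc t _ w ⟩
  t * (sum (λ y → ⟦ B y ⟧ * # (λ x → A x ∧ R x y)) * w)
    ≡⟨ cong (t *_) (*-distribʳ-sum w (λ y → ⟦ B y ⟧ * # (λ x → A x ∧ R x y))) ⟩
  t * sum (λ y → ⟦ B y ⟧ * # (λ x → A x ∧ R x y) * w)
    ≡⟨ cong (t *_) (sum-cong-≗ (λ y → *-assoc ⟦ B y ⟧ _ w)) ⟩
  t * sum (λ y → ⟦ B y ⟧ * (# (λ x → A x ∧ R x y) * w))
    ≤⟨ *-monoʳ-≤ t (sum-in B (λ y → # (λ x → A x ∧ R x y) * w) u few) ⟩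
  t * (# B * u)
    ≡⟨ x∙yz≈y∙xz t (# B) u ⟩
  # B * (t * u) ∎)
  where open ≤-Reasoning

-- Greedy embeddings

∨-elim : ∀ {a b} → a ∨ b ≡ true → a ≡ true ⊎ b ≡ true
∨-elim {true}  _ = inj₁ refl
∨-elim {false} p = inj₂ p

∨-false : ∀ {a b} → a ∨ b ≡ false → a ≡ false × b ≡ false
∨-false {false} {false} _ = refl , refl

Transversal : ∀ n → (Fin n → Fin n → Fin N → Fin N → Bool) → (Fin n → Sub N) → Set
Transversal {N} n Rel V = Σ (Fin n → Fin N) λ f →
  (∀ j → V j (f j) ≡ true) × (∀ a b → a 𝔽.< b → Rel a b (f a) (f b) ≡ true)

-- The factor `G` on the side of `A` comes from pigeonhole: `A` is a share of at least `1 / G` of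
-- the candidates, those failing at one common later index, whereas `B` is a whole candidate set.
SparsePair : ∀ n → (G e s : ℕ) → (Fin n → Fin n → Fin N → Fin N → Bool) → (Fin n → Sub N) → Set
SparsePair {N} n G e s Rel V = ∃₂ λ a b → a 𝔽.< b × ∃₂ λ (A B : Sub N) →
  A ⊆ V a × B ⊆ V b × s ≤ G * # A × s ≤ # B ×
  (∀ x → A x ≡ true → 2 ^ e * # (B ∩ Rel a b x) < # B)

extend : ∀ {n} {A : Set} → A → (Fin n → A) → Fin (suc n) → A
extend x f zero    = x
extend x f (suc i) = f i

-- A choice is bad for a later index if it cuts the candidates there by more than `2 ^ e`. Either
-- some later index has a share `1 / G` of bad choices, which is a sparse pair, or the union bound
-- leaves a choice that is good for all. Each set is cut fewer than `n` times while it is in use, so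
-- it keeps size `s`.
greedy : ∀ n (G e s : ℕ) → n ≤ G → 0 < s →
  (Rel : Fin n → Fin n → Fin N → Fin N → Bool) (V : Fin n → Sub N) →
  (∀ j → s * 2 ^ (e * n) ≤ # (V j)) →
  Transversal n Rel V ⊎ SparsePair n G e s Rel V
greedy zero G e s _ _ Rel V _ = inj₁ ((λ ()) , (λ ()) , (λ ()))
greedy {N} (suc n) G e s n<G s>0 Rel V size
  with any? (λ j → # (V zero) ≤? G * # (V zero ∩ bad j))
  where
  bad : Fin n → Sub N
  bad j x = 2 ^ e * # (V (suc j) ∩ Rel zero (suc j) x) <ᴮ # (V (suc j))
... | yes (j , p) = inj₂ (zero , suc j , s≤s z≤n , _ , V (suc j) , (λ x → ∧-elimˡ) , (λ _ y → y) ,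
        ≤-trans (s≤# zero) p , s≤# (suc j) ,
        λ x p → <ᴮ⇒< (∧-elimʳ {V zero x} p))
  where
  s≤# : ∀ j → s ≤ # (V j)
  s≤# j = ≤-trans (m≤m*n s (2 ^ (e * suc n)) ⦃ >-nonZero (m^n>0 2 (e * suc n)) ⦄) (size j)
... | no ¬p = result
  where
  bad : Fin n → Sub N
  bad j x = 2 ^ e * # (V (suc j) ∩ Rel zero (suc j) x) <ᴮ # (V (suc j))
  -- The failed comparison is strict, so `G` times a bad set is at most `# (V zero)` minus one; this
  -- unit gives `avoid` its strict inequality.
  u = pred (# (V zero))
  V0>0 : 0 < # (V zero)
  V0>0 = ≤-trans s>0 (≤-trans (m≤m*n s (2 ^ (e * suc n)) ⦃ >-nonZero (m^n>0 2 (e * suc n)) ⦄) (size zero))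
  suc-u : suc u ≡ # (V zero)
  suc-u = suc-pred (# (V zero)) ⦃ >-nonZero V0>0 ⦄
  few : ∀ j → # (V zero ∩ bad j) * G ≤ u
  few j = ≤-pred (≤-trans (s≤s (≤-reflexive (*-comm _ G)))
             (≤-trans (≰⇒> (λ q → ¬p (j , q))) (≤-reflexive (sym suc-u))))
  big : n * u < # (V zero) * G
  big = begin-strict
    n * u     ≤⟨ *-monoˡ-≤ u (<⇒≤ n<G) ⟩
    G * u     ≡⟨ *-comm G u ⟩
    u * G     <⟨ *-monoˡ-< G ⦃ >-nonZero (≤-trans (s≤s z≤n) n<G) ⦄ (n<1+n u) ⟩
    suc u * G ≡⟨ cong (_* G) suc-u ⟩
    # (V zero) * G ∎
    where open ≤-Reasoning
  ch = avoid (V zero) bad G u few big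
  x  = proj₁ ch
  V′ : Fin n → Sub N
  V′ j = V (suc j) ∩ Rel zero (suc j) x
  size′ : ∀ j → s * 2 ^ (e * n) ≤ # (V′ j)
  size′ j = *-cancelˡ-≤ (2 ^ e) ⦃ >-nonZero (m^n>0 2 e) ⦄ (begin
    2 ^ e * (s * 2 ^ (e * n)) ≡⟨ x∙yz≈y∙xz (2 ^ e) s _ ⟩
    s * (2 ^ e * 2 ^ (e * n)) ≡⟨ cong (s *_) (^-distribˡ-+-* 2 e (e * n)) ⟨
    s * 2 ^ (e + e * n)       ≡⟨ cong (λ z → s * 2 ^ z) (*-suc e n) ⟨
    s * 2 ^ (e * suc n)       ≤⟨ size (suc j) ⟩
    # (V (suc j))             ≤⟨ ≮ᴮ⇒≥ (proj₂ (proj₂ ch) j) ⟩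
    2 ^ e * # (V′ j)          ∎)
    where
    open ≤-Reasoning
  result : Transversal (suc n) Rel V ⊎ SparsePair (suc n) G e s Rel V
  result with greedy n G e s (<⇒≤ n<G) s>0 (λ a b → Rel (suc a) (suc b)) V′ size′
  ... | inj₂ (a , b , a<b , A , B , A⊆ , B⊆ , rest) =
    inj₂ (suc a , suc b , s≤s a<b , A , B , (λ x p → ∧-elimˡ (A⊆ x p)) , (λ x p → ∧-elimˡ (B⊆ x p)) , rest)
  ... | inj₁ (f , f∈ , f-rel) = inj₁ (extend x f , ∈′ , rel′)
    where
    ∈′ : ∀ j → V j (extend x f j) ≡ true
    ∈′ zero    = proj₁ (proj₂ ch)
    ∈′ (suc j) = ∧-elimˡ (f∈ j)
    rel′ : ∀ a b → a 𝔽.< b → Rel a b (extend x f a) (extend x f b) ≡ true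
    rel′ zero    (suc b) _         = ∧-elimʳ {V (suc b) (f b)} (f∈ b)
    rel′ (suc a) (suc b) (s≤s a<b) = f-rel a b a<b

-- Pseudo-random labellings and embeddings that avoid forbidden pairs

module PseudoRandom {N K : ℕ} (ℓ : Fin N → Fin N → Fin K) where

  opaque
    has : Fin K → Fin N → Fin N → Bool
    has c x y = does (ℓ x y 𝔽.≟ c)

    has⇒≡ : ∀ {c} x y → has c x y ≡ true → ℓ x y ≡ c
    has⇒≡ {c} x y = does⇒ (ℓ x y 𝔽.≟ c)

    ≡⇒has : ∀ {c} x y → ℓ x y ≡ c → has c x y ≡ true
    ≡⇒has {c} x y = ⇒does (ℓ x y 𝔽.≟ c)

  -- The mean number of `c`-neighbours in `S` is `# S / K`, and `A` consists of vertices with less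
  -- than half of it. Bounding the product `# A * # S` lets one `Q` serve sets of all sizes.
  MostHaveManyNeighbours : ℕ → Set
  MostHaveManyNeighbours Q = ∀ c (A S : Sub N) →
    (∀ x → A x ≡ true → 2 * K * # (S ∩ has c x) < # S) → # A * # S ≤ Q

  -- The threshold is twice the mean for a set of size `w / T`, an upper bound for `# S`, and not
  -- for `# S` itself: the sets in question are forbidden neighbourhoods, which may be tiny or
  -- empty.
  MostHaveFewNeighbours : ℕ → Set
  MostHaveFewNeighbours Q = ∀ c (A S : Sub N) T w → T * # S ≤ w →
    (∀ x → A x ≡ true → 2 * w < T * (K * # (S ∩ has c x))) → # A * w ≤ T * Q

module BlueEmbedding {N K : ℕ} ⦃ K≢0 : NonZero K ⦄ (ℓ : Fin N → Fin N → Fin K) (Q : ℕ)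
  (many : PseudoRandom.MostHaveManyNeighbours ℓ Q) (fewN : PseudoRandom.MostHaveFewNeighbours ℓ Q)
  (G ω Tmax : ℕ) (τ : ℕ → ℕ) (τ-suc : ∀ n → τ (suc n) ≡ 16 * τ n)
  (8K≤τ : ∀ n → 8 * K ≤ τ n) (τ≤Tmax : ∀ n → n ≤ G → τ n ≤ Tmax)
  (budget : G * (Q + 8 * K * (G * (Tmax * Q))) < ω * ω) where

  open PseudoRandom ℓ

  -- F is the set of forbidden pairs. Besides giving x many neighbours with the right labels, the choice of x discards every y whose
  -- forbidden neighbourhood concentrates on that of x; hence the density of F grows by a factor 16 per step, not by K.
  embed-avoiding : ∀ n → n ≤ G → (c : Fin n → Fin n → Fin K) (F : Fin n → Fin n → Fin N → Fin N → Bool)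
    (W : Fin n → Sub N) →
    (∀ b → ω * (8 * K) ^ n ≤ # (W b)) →
    (∀ a b → a 𝔽.< b → ∀ x → W a x ≡ true → τ n * # (W b ∩ F a b x) ≤ # (W b)) →
    Transversal n (λ a b x y → has (c a b) x y ∧ not (F a b x y)) W
  embed-avoiding zero _ c F W _ _ = (λ ()) , (λ ()) , (λ ())
  embed-avoiding (suc n) n<G c F W size sparse = extend x f , ∈′ , rel′
    where
    T = τ (suc n)
    Wₛ : Fin n → Sub N
    Wₛ b = W (suc b)
    hit : Fin n → Fin N → Fin N → Bool
    hit b = has (c zero (suc b))
    Fₛ : Fin n → Fin n → Fin N → Fin N → Bool
    Fₛ a b = F (suc a) (suc b)
    -- Sparsity bounds the forbidden part of `Wₛ b′` at `y` by `# (Wₛ b′) / T`, and about `1 / K` of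
    -- it should be neighbours of `x`; crowded means more than twice that. The test `b < b′` is
    -- there because sparsity is known in that direction only.
    crowded : Fin n → Fin n → Fin N → Fin N → Bool
    crowded b b′ x y = does (b 𝔽.<? b′) ∧ (2 * # (Wₛ b′) <ᴮ T * (K * # ((Wₛ b′ ∩ Fₛ b b′ y) ∩ hit b′ x)))
    spoilt : Fin n → Fin N → Fin N → Bool
    spoilt b x y = anyᴮ (λ b′ → crowded b b′ x y)
    poor spoiling bad : Fin n → Sub N
    poor b x = 2 * K * # (Wₛ b ∩ hit b x) <ᴮ # (Wₛ b)
    spoiling b x = # (Wₛ b) <ᴮ 8 * K * # (Wₛ b ∩ spoilt b x)
    bad b x = poor b x ∨ spoiling b x

    8K≥1 : 1 ≤ 8 * K
    8K≥1 = ≤-trans (>-nonZero⁻¹ K) (m≤n*m K 8)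
    ω≤ : ∀ b → ω ≤ # (W b)
    ω≤ b = ≤-trans (m≤m*n ω ((8 * K) ^ suc n) ⦃ m^n≢0 (8 * K) (suc n) ⦃ >-nonZero 8K≥1 ⦄ ⦄) (size b)
    ω>0 : 0 < ω
    ω>0 = n≢0⇒n>0 λ { refl → n≮0 budget }
    T≤Tmax : T ≤ Tmax
    T≤Tmax = τ≤Tmax (suc n) n<G

    few-poor : ∀ b → # (W zero ∩ poor b) * ω ≤ Q
    few-poor b = ≤-trans (*-monoʳ-≤ (# (W zero ∩ poor b)) (ω≤ (suc b)))
      (many (c zero (suc b)) (W zero ∩ poor b) (Wₛ b) (λ x p → <ᴮ⇒< (∧-elimʳ {W zero x} p)))

    -- With `y` fixed and `x` varying, the set in which neighbours are counted is fixed, so `fewN`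
    -- applies to it.
    few-crowded : ∀ b y → Wₛ b y ≡ true → ∀ b′ → # (λ x → W zero x ∧ crowded b b′ x y) * ω ≤ Tmax * Q
    few-crowded b y y∈ b′ = go (b 𝔽.<? b′)
      where
      S : Sub N
      S x = W zero x ∧ crowded b b′ x y
      S⇒ : ∀ x → S x ≡ true → b 𝔽.< b′ × 2 * # (Wₛ b′) < T * (K * # ((Wₛ b′ ∩ Fₛ b b′ y) ∩ hit b′ x))
      S⇒ x p = does⇒ (b 𝔽.<? b′) (∧-elimˡ q) , <ᴮ⇒< (∧-elimʳ {does (b 𝔽.<? b′)} q)
        where q = ∧-elimʳ {W zero x} p
      go : Dec (b 𝔽.< b′) → # S * ω ≤ Tmax * Q
      go (no b≮b′) = ≤-trans (≤-reflexive (cong (_* ω) (#-empty S (λ x → 𝔹.¬-not λ p → b≮b′ (proj₁ (S⇒ x p)))))) z≤n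
      go (yes b<b′) = ≤-trans (*-monoʳ-≤ (# S) (ω≤ (suc b′))) (≤-trans
        (fewN (c zero (suc b′)) S (Wₛ b′ ∩ Fₛ b b′ y) T (# (Wₛ b′)) (sparse (suc b) (suc b′) (s≤s b<b′) y y∈)
          (λ x p → proj₂ (S⇒ x p)))
        (*-monoˡ-≤ Q T≤Tmax))

    -- Each `y` is spoilt by few `x`; by double counting, few `x` can spoil a share `1 / (8 * K)` of
    -- `Wₛ b`.
    few-spoiling : ∀ b → # (W zero ∩ spoiling b) * ω ≤ 8 * K * (G * (Tmax * Q))
    few-spoiling b = dense-few (W zero) (W zero ∩ spoiling b) (Wₛ b) (spoilt b) ω (G * (Tmax * Q)) (8 * K)
      (≤-trans ω>0 (ω≤ (suc b))) (λ x → ∧-elimˡ)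
      (λ y y∈ → ≤-trans
        (#-⋃ (λ x → W zero x ∧ spoilt b x y) (λ b′ x → W zero x ∧ crowded b b′ x y) ω (Tmax * Q)
          (λ x p → let b′ , q = anyᴮ⇒∃ (λ b′ → crowded b b′ x y) (∧-elimʳ {W zero x} p) in
                   b′ , ∧-intro (∧-elimˡ {W zero x} p) q)
          (few-crowded b y y∈))
        (*-monoˡ-≤ (Tmax * Q) (<⇒≤ n<G)))
      (λ x p → <⇒≤ (<ᴮ⇒< (∧-elimʳ {W zero x} p)))

    u = Q + 8 * K * (G * (Tmax * Q))

    few-bad : ∀ b → # (W zero ∩ bad b) * ω ≤ u
    few-bad b = begin
      # (W zero ∩ bad b) * ω
        ≤⟨ *-monoˡ-≤ ω (#-∪ (W zero ∩ bad b) (W zero ∩ poor b) (W zero ∩ spoiling b) cov) ⟩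
      (# (W zero ∩ poor b) + # (W zero ∩ spoiling b)) * ω
        ≡⟨ *-distribʳ-+ ω (# (W zero ∩ poor b)) _ ⟩
      # (W zero ∩ poor b) * ω + # (W zero ∩ spoiling b) * ω
        ≤⟨ +-mono-≤ (few-poor b) (few-spoiling b) ⟩
      u ∎
      where
      open ≤-Reasoning
      cov : ∀ x → (W zero ∩ bad b) x ≡ true → (W zero ∩ poor b) x ≡ true ⊎ (W zero ∩ spoiling b) x ≡ true
      cov x p = Sum.map
        (λ q → (∧-intro (∧-elimˡ {W zero x} p) q))
        (λ q → (∧-intro (∧-elimˡ {W zero x} p) q))
        (∨-elim {poor b x} (∧-elimʳ {W zero x} p))

    choice = avoid (W zero) bad ω u few-bad
      (≤-<-trans (*-monoˡ-≤ u (<⇒≤ n<G)) (<-≤-trans budget (*-monoˡ-≤ ω (ω≤ zero))))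
    x = proj₁ choice
    not-poor : ∀ b → # (Wₛ b) ≤ 2 * K * # (Wₛ b ∩ hit b x)
    not-poor b = ≮ᴮ⇒≥ (proj₁ (∨-false {poor b x} (proj₂ (proj₂ choice) b)))
    not-spoiling : ∀ b → 8 * K * # (Wₛ b ∩ spoilt b x) ≤ # (Wₛ b)
    not-spoiling b = ≮ᴮ⇒≥ (proj₂ (∨-false {poor b x} (proj₂ (proj₂ choice) b)))

    W′ : Fin n → Sub N
    W′ b y = Wₛ b y ∧ ((hit b x y ∧ not (F zero (suc b) x y)) ∧ not (spoilt b x y))

    -- In units of `# (Wₛ b) / (8 * K)`: at least four units carry the right label, at most one is
    -- forbidden at `x` and at most one is spoilt, so at least two remain.
    W≤8KW′ : ∀ b → # (Wₛ b) ≤ 8 * K * # (W′ b)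
    W≤8KW′ b = +-cancelˡ-≤ (# (Wₛ b) + # (Wₛ b)) _ _ (begin
      # (Wₛ b) + # (Wₛ b) + # (Wₛ b)     ≤⟨ m≤m+n _ (# (Wₛ b)) ⟩
      # (Wₛ b) + # (Wₛ b) + # (Wₛ b) + # (Wₛ b)     ≡⟨ four (# (Wₛ b)) ⟩
      4 * # (Wₛ b)                       ≤⟨ *-monoʳ-≤ 4 (not-poor b) ⟩
      4 * (2 * K * # (Wₛ b ∩ hit b x))   ≡⟨ eight K _ ⟩
      8 * K * # (Wₛ b ∩ hit b x)         ≤⟨ *-monoʳ-≤ (8 * K) (≤-trans (#-∪ _ (Wₛ b ∩ F zero (suc b) x) rest cov₁)
                                              (+-monoʳ-≤ _ (#-∪ rest (Wₛ b ∩ spoilt b x) (W′ b) cov₂))) ⟩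
      8 * K * (# (Wₛ b ∩ F zero (suc b) x) + (# (Wₛ b ∩ spoilt b x) + # (W′ b)))
        ≡⟨ dist (8 * K) (# (Wₛ b ∩ F zero (suc b) x)) _ _ ⟩
      8 * K * # (Wₛ b ∩ F zero (suc b) x) + 8 * K * # (Wₛ b ∩ spoilt b x) + 8 * K * # (W′ b)
        ≤⟨ +-monoˡ-≤ _ (+-mono-≤ (≤-trans (*-monoˡ-≤ _ 8K≤T) (sparse zero (suc b) (s≤s z≤n) x (proj₁ (proj₂ choice)))) (not-spoiling b)) ⟩
      # (Wₛ b) + # (Wₛ b) + 8 * K * # (W′ b) ∎)
      where
      open ≤-Reasoning
      rest : Sub N
      rest y = Wₛ b y ∧ (hit b x y ∧ not (F zero (suc b) x y))
      four : ∀ z → z + z + z + z ≡ 4 * z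
      four = solve-∀
      eight : ∀ k z → 4 * (2 * k * z) ≡ 8 * k * z
      eight = solve-∀
      dist : ∀ k p q r → k * (p + (q + r)) ≡ k * p + k * q + k * r
      dist = solve-∀
      8K≤T : 8 * K ≤ T
      8K≤T = 8K≤τ (suc n)
      cov₁ : ∀ y → (Wₛ b ∩ hit b x) y ≡ true → (Wₛ b ∩ F zero (suc b) x) y ≡ true ⊎ rest y ≡ true
      cov₁ y p = Sum.map
        (λ q → (∧-intro (∧-elimˡ {Wₛ b y} p) q))
        (λ q → (∧-intro (∧-elimˡ {Wₛ b y} p) (∧-intro (∧-elimʳ {Wₛ b y} p) (cong not q))))
        (true? (F zero (suc b) x y))
      cov₂ : ∀ y → rest y ≡ true → (Wₛ b ∩ spoilt b x) y ≡ true ⊎ W′ b y ≡ true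
      cov₂ y p = Sum.map
        (λ q → (∧-intro (∧-elimˡ {Wₛ b y} p) q))
        (λ q → (∧-intro (∧-elimˡ {Wₛ b y} p) (∧-intro (∧-elimʳ {Wₛ b y} p) (cong not q))))
        (true? (spoilt b x y))

    size′ : ∀ b → ω * (8 * K) ^ n ≤ # (W′ b)
    size′ b = *-cancelˡ-≤ (8 * K) ⦃ >-nonZero 8K≥1 ⦄ (≤-trans (≤-trans
      (≤-reflexive (x∙yz≈y∙xz (8 * K) ω _)) (size (suc b))) (W≤8KW′ b))

    -- An unspoilt `y` keeps at most `2 * # (Wₛ b) / (T * K)` forbidden partners, while `W′ b` is
    -- smaller than `Wₛ b` by at most the factor `8 * K`. The two factors `K` cancel, which leaves 2
    -- * 8 = 16.
    sparse′ : ∀ a b → a 𝔽.< b → ∀ y → W′ a y ≡ true → τ n * # (W′ b ∩ Fₛ a b y) ≤ # (W′ b)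
    sparse′ a b a<b y y∈ = *-cancelˡ-≤ (16 * K) ⦃ m*n≢0 16 K ⦄ (begin
      16 * K * (τ n * # (W′ b ∩ Fₛ a b y))  ≡⟨ rearr K (τ n) _ ⟩
      16 * τ n * (K * # (W′ b ∩ Fₛ a b y))          ≡⟨ cong (_* (K * # (W′ b ∩ Fₛ a b y))) (τ-suc n) ⟨
      T * (K * # (W′ b ∩ Fₛ a b y))                 ≤⟨ *-monoʳ-≤ T (*-monoʳ-≤ K (#-mono _ _ sub)) ⟩
      T * (K * # ((Wₛ b ∩ Fₛ a b y) ∩ hit b x))     ≤⟨ ≮ᴮ⇒≥ uncrowded ⟩
      2 * # (Wₛ b)                                  ≤⟨ *-monoʳ-≤ 2 (W≤8KW′ b) ⟩
      2 * (8 * K * # (W′ b))                        ≡⟨ sixteen K _ ⟩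
      16 * K * # (W′ b)                             ∎)
      where
      open ≤-Reasoning
      rearr : ∀ k t z → 16 * k * (t * z) ≡ 16 * t * (k * z)
      rearr = solve-∀
      sixteen : ∀ k z → 2 * (8 * k * z) ≡ 16 * k * z
      sixteen = solve-∀
      unspoilt : spoilt a x y ≡ false
      unspoilt = not-elim (∧-elimʳ {hit a x y ∧ not (F zero (suc a) x y)} (∧-elimʳ {Wₛ a y} y∈))
      uncrowded : (2 * # (Wₛ b) <ᴮ T * (K * # ((Wₛ b ∩ Fₛ a b y) ∩ hit b x))) ≡ false
      uncrowded = ∧-falseʳ (⇒does (a 𝔽.<? b) a<b)
                    (¬anyᴮ⇒∀ (λ b′ → crowded a b′ x y) unspoilt b)
      sub : (W′ b ∩ Fₛ a b y) ⊆ ((Wₛ b ∩ Fₛ a b y) ∩ hit b x)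
      sub z p = ∧-intro (∧-intro (∧-elimˡ {Wₛ b z} z∈) (∧-elimʳ {W′ b z} p))
                        (∧-elimˡ {hit b x z} (∧-elimˡ {hit b x z ∧ not (F zero (suc b) x z)} (∧-elimʳ {Wₛ b z} z∈)))
        where z∈ = ∧-elimˡ {W′ b z} p

    ih = embed-avoiding n (<⇒≤ n<G) (λ a b → c (suc a) (suc b)) Fₛ W′ size′ sparse′
    f = proj₁ ih
    f∈ = proj₁ (proj₂ ih)
    ∈′ : ∀ j → W j (extend x f j) ≡ true
    ∈′ zero    = proj₁ (proj₂ choice)
    ∈′ (suc j) = ∧-elimˡ (f∈ j)
    rel′ : ∀ a b → a 𝔽.< b → has (c a b) (extend x f a) (extend x f b) ∧ not (F a b (extend x f a) (extend x f b)) ≡ true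
    rel′ zero    (suc b) _         = ∧-elimˡ (∧-elimʳ {W (suc b) (f b)} (f∈ b))
    rel′ (suc a) (suc b) (s≤s a<b) = proj₂ (proj₂ ih) a b a<b

-- Graphs from ordered labellings

sum-mono-< : (f g : Fin n → ℕ) → (∀ i → f i ≤ g i) → ∀ i → f i < g i → sum f < sum g
sum-mono-< f g h zero    p = +-mono-<-≤ p (sum-mono (f ∘ suc) (g ∘ suc) (h ∘ suc))
sum-mono-< f g h (suc i) p = +-mono-≤-< (h zero) (sum-mono-< (f ∘ suc) (g ∘ suc) (h ∘ suc) i p)

module _ (H : EOGraph n) where

  opaque
    below : ℕ → Fin n → Fin n → ℕ
    below r c d = ⟦ adj H c d ∧ (rank H c d <ᴮ r) ⟧

    -- Ranks in `H` may be arbitrarily large; counting compresses them to numbers up to `n * n` and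
    -- keeps their strict order. Each edge is counted in both orientations, which does not disturb
    -- that order.
    edgesBelow : ℕ → ℕ
    edgesBelow r = sum (λ c → sum (below r c))

    edgesBelow≤ : ∀ r → edgesBelow r ≤ n * n
    edgesBelow≤ r = sum-const≤ (λ c → sum (below r c)) n λ c →
      ≤-trans (sum-const≤ (below r c) 1 λ d → ⟦⟧-mono {b = true} (λ _ → refl)) (≤-reflexive (*-identityʳ n))

    edgesBelow-< : ∀ a b r → adj H a b ≡ true → rank H a b < r → edgesBelow (rank H a b) < edgesBelow r
    edgesBelow-< a b r ab lt =
      sum-mono-< (λ c → sum (below r₀ c)) (λ c → sum (below r c)) (λ c → sum-mono (below r₀ c) (below r c) (mono c)) a
        (sum-mono-< (below r₀ a) (below r a) (mono a) b strict)
      where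
      r₀ : ℕ
      r₀ = rank H a b
      mono : ∀ c d → below r₀ c d ≤ below r c d
      mono c d = ⟦⟧-mono λ p → ∧-intro (∧-elimˡ p) (<⇒<ᴮ (<-trans (<ᴮ⇒< (∧-elimʳ {adj H c d} p)) lt))
      strict : below r₀ a b < below r a b
      strict = subst₂ (λ s t → ⟦ s ⟧ < ⟦ t ⟧)
        (sym (𝔹.¬-not {adj H a b ∧ (r₀ <ᴮ r₀)} λ p → <-irrefl refl (<ᴮ⇒< (∧-elimʳ {adj H a b} p))))
        (sym (∧-intro ab (<⇒<ᴮ lt))) ≤-refl

  position : Fin n → Fin n → ℕ
  position a b = edgesBelow (rank H a b)

  position-sym : ∀ a b → position a b ≡ position b a
  position-sym a b = cong edgesBelow (rank-sym H a b)

module LabelledGraph {N K : ℕ} (ℓ : Fin N → Fin N → Fin K)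
  (ℓ-sym : ∀ x y → ℓ x y ≡ ℓ y x) (ℓ-diag : ∀ x → toℕ (ℓ x x) ≡ 0) where

  lab : Fin N → Fin N → ℕ
  lab x y = toℕ (ℓ x y)

  lower upper : Fin N → Fin N → Fin N
  lower u v = fromℕ< (≤-<-trans (m⊓n≤m (toℕ u) (toℕ v)) (𝔽.toℕ<n u))
  upper u v = fromℕ< {toℕ u ⊔ toℕ v} (⊔-lub (𝔽.toℕ<n u) (𝔽.toℕ<n v))

  -- Separates edges of equal label. Coding an unordered pair by its minimum and maximum makes the
  -- rank symmetric and injective; as the lower digit of the rank it never overrules a difference of
  -- labels.
  tie : Fin N → Fin N → Fin (N * N)
  tie u v = combine (lower u v) (upper u v)

  toℕ-lower : ∀ u v → toℕ (lower u v) ≡ toℕ u ⊓ toℕ v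
  toℕ-lower u v = 𝔽.toℕ-fromℕ< _

  toℕ-upper : ∀ u v → toℕ (upper u v) ≡ toℕ u ⊔ toℕ v
  toℕ-upper u v = 𝔽.toℕ-fromℕ< _

  tie-sym : ∀ u v → tie u v ≡ tie v u
  tie-sym u v = cong₂ combine
    (𝔽.toℕ-injective (trans (toℕ-lower u v) (trans (⊓-comm _ _) (sym (toℕ-lower v u)))))
    (𝔽.toℕ-injective (trans (toℕ-upper u v) (trans (⊔-comm (toℕ u) _) (sym (toℕ-upper v u)))))

  min-max-determine : ∀ {a b c d} → a ⊓ b ≡ c ⊓ d → a ⊔ b ≡ c ⊔ d → (a ≡ c × b ≡ d) ⊎ (a ≡ d × b ≡ c)
  min-max-determine {a} {b} {c} {d} p q with ≤-total a b | ≤-total c d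
  ... | inj₁ ab | inj₁ cd = inj₁ (trans (sym (m≤n⇒m⊓n≡m ab)) (trans p (m≤n⇒m⊓n≡m cd)) ,
                                  trans (sym (m≤n⇒m⊔n≡n ab)) (trans q (m≤n⇒m⊔n≡n cd)))
  ... | inj₁ ab | inj₂ dc = inj₂ (trans (sym (m≤n⇒m⊓n≡m ab)) (trans p (m≥n⇒m⊓n≡n dc)) ,
                                  trans (sym (m≤n⇒m⊔n≡n ab)) (trans q (m≥n⇒m⊔n≡m dc)))
  ... | inj₂ ba | inj₁ cd = inj₂ (trans (sym (m≥n⇒m⊔n≡m ba)) (trans q (m≤n⇒m⊔n≡n cd)) ,
                                  trans (sym (m≥n⇒m⊓n≡n ba)) (trans p (m≤n⇒m⊓n≡m cd)))
  ... | inj₂ ba | inj₂ dc = inj₁ (trans (sym (m≥n⇒m⊔n≡m ba)) (trans q (m≥n⇒m⊔n≡m dc)) ,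
                                  trans (sym (m≥n⇒m⊓n≡n ba)) (trans p (m≥n⇒m⊓n≡n dc)))

  tie-injective : ∀ a b c d → tie a b ≡ tie c d → (a ≡ c × b ≡ d) ⊎ (a ≡ d × b ≡ c)
  tie-injective a b c d p
    with q , r ← 𝔽.combine-injective (lower a b) (upper a b) (lower c d) (upper c d) p
    with min-max-determine (trans (sym (toℕ-lower a b)) (trans (cong toℕ q) (toℕ-lower c d)))
                           (trans (sym (toℕ-upper a b)) (trans (cong toℕ r) (toℕ-upper c d)))
  ... | inj₁ (s , t) = inj₁ (𝔽.toℕ-injective s , 𝔽.toℕ-injective t)
  ... | inj₂ (s , t) = inj₂ (𝔽.toℕ-injective s , 𝔽.toℕ-injective t)

  -- Label 0 occurs on the diagonal, so label 1 marks the non-adjacent pairs of distinct vertices that are used.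
  graph : EOGraph N
  graph = record
    { adj      = λ u v → 1 <ᵇ lab u v
    ; adj-sym  = λ u v → cong (λ c → 1 <ᵇ toℕ c) (ℓ-sym u v)
    ; adj-irr  = λ u → cong (1 <ᵇ_) (ℓ-diag u)
    ; rank     = λ u v → toℕ (combine (ℓ u v) (tie u v))
    ; rank-sym = λ u v → cong toℕ (cong₂ combine (ℓ-sym u v) (tie-sym u v))
    ; rank-inj = λ a b c d _ _ p → tie-injective a b c d
        (𝔽.combine-injectiveʳ (ℓ a b) (tie a b) (ℓ c d) (tie c d) (𝔽.toℕ-injective p))
    }

  module _ (H : EOGraph n) (χ : Colouring graph) (f : Fin n → Fin N) (lo w : ℕ) (w>0 : 0 < w) (κ : Bool)
    (edge : ∀ a b → a 𝔽.< b → adj H a b ≡ true →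
      lo + (2 + position H a b) * w ≤ lab (f a) (f b) × lab (f a) (f b) < lo + (3 + position H a b) * w
      × col χ (f a) (f b) ≡ κ)
    (non-edge : ∀ a b → a 𝔽.< b → adj H a b ≡ false → lab (f a) (f b) ≡ 1) where

    lab-sym : ∀ x y → lab x y ≡ lab y x
    lab-sym x y = cong toℕ (ℓ-sym x y)

    edge′ : ∀ a b → adj H a b ≡ true →
      lo + (2 + position H a b) * w ≤ lab (f a) (f b) × lab (f a) (f b) < lo + (3 + position H a b) * w
      × col χ (f a) (f b) ≡ κ
    edge′ a b ab with 𝔽.<-cmp a b
    ... | tri< lt _ _ = edge a b lt ab
    ... | tri≈ _ refl _ with () ← trans (sym (adj-irr H a)) ab
    ... | tri> _ _ gt rewrite position-sym H a b | lab-sym (f a) (f b) | col-sym χ (f a) (f b) =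
      edge b a gt (trans (adj-sym H b a) ab)

    non-edge′ : ∀ a b → a ≢ b → adj H a b ≡ false → lab (f a) (f b) ≡ 1
    non-edge′ a b a≢b ab with 𝔽.<-cmp a b
    ... | tri< lt _ _ = non-edge a b lt ab
    ... | tri≈ _ a≡b _ = ⊥-elim (a≢b a≡b)
    ... | tri> _ _ gt rewrite lab-sym (f a) (f b) = non-edge b a gt (trans (adj-sym H b a) ab)

    -- The offset 2 in the number of the subinterval, together with `w > 0`, keeps edges off the
    -- labels 0 and 1.
    edge-label : ∀ a b → adj H a b ≡ true → 2 ≤ lab (f a) (f b)
    edge-label a b ab = ≤-trans (≤-trans (*-mono-≤ {2} {2 + position H a b} {1} (m≤m+n 2 _) w>0) (m≤n+m _ lo)) (proj₁ (edge′ a b ab))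

    preserves-adj : ∀ a b → adj graph (f a) (f b) ≡ adj H a b
    preserves-adj a b with true? (adj H a b)
    ... | inj₁ ab = trans (⇒does (1 <? lab (f a) (f b)) (edge-label a b ab)) (sym ab)
    ... | inj₂ ab with a 𝔽.≟ b
    ...   | yes refl = trans (adj-irr graph (f a)) (sym ab)
    ...   | no a≢b   = trans (cong (1 <ᵇ_) (non-edge′ a b a≢b ab)) (sym ab)

    -- A collapsed pair would carry the diagonal label 0, whereas edges carry labels of at least 2
    -- and distinct non-adjacent vertices carry 1.
    injective : ∀ {a b} → f a ≡ f b → a ≡ b
    injective {a} {b} p with a 𝔽.≟ b
    ... | yes q = q
    ... | no a≢b with lab≡0 ← trans (cong (lab (f a)) (sym p)) (ℓ-diag (f a)) | true? (adj H a b)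
    ...   | inj₁ ab = ⊥-elim (<⇒≢ (≤-trans (s≤s z≤n) (edge-label a b ab)) (sym lab≡0))
    ...   | inj₂ ab with () ← trans (sym (non-edge′ a b a≢b ab)) lab≡0

    -- The subintervals of two edges are disjoint and follow the order of positions, so the labels
    -- alone decide the comparison.
    rank-< : ∀ a b c d → adj H a b ≡ true → adj H c d ≡ true →
      rank H a b < rank H c d → rank graph (f a) (f b) < rank graph (f c) (f d)
    rank-< a b c d ab cd lt = 𝔽.combine-monoˡ-< (tie (f a) (f b)) (tie (f c) (f d)) (begin-strict
      lab (f a) (f b)                   <⟨ proj₁ (proj₂ (edge′ a b ab)) ⟩
      lo + (3 + position H a b) * w     ≤⟨ +-monoʳ-≤ lo (*-monoˡ-≤ w (+-monoʳ-≤ 2 (edgesBelow-< H a b _ ab lt))) ⟩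
      lo + (2 + position H c d) * w     ≤⟨ proj₁ (edge′ c d cd) ⟩
      lab (f c) (f d)                   ∎)
      where open ≤-Reasoning

    rank-<⁻¹ : ∀ a b c d → adj H a b ≡ true → adj H c d ≡ true →
      rank graph (f a) (f b) < rank graph (f c) (f d) → rank H a b < rank H c d
    rank-<⁻¹ a b c d ab cd lt with <-cmp (rank H a b) (rank H c d)
    ... | tri< p _ _ = p
    ... | tri> _ _ p = ⊥-elim (<-asym lt (rank-< c d a b cd ab p))
    ... | tri≈ _ p _ with rank-inj H a b c d ab cd p
    ...   | inj₁ (refl , refl) = ⊥-elim (<-irrefl refl lt)
    ...   | inj₂ (refl , refl) = ⊥-elim (<-irrefl (rank-sym graph (f a) (f b)) lt)

    monoInducedCopy : MonoInducedCopy H graph χ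
    monoInducedCopy = f , record
      { inj = injective
      ; adj-pres = preserves-adj
      ; ord-pres = λ a b c d ab cd → mk⇔ (rank-< a b c d ab cd) (rank-<⁻¹ a b c d ab cd)
      } , κ , λ a b ab → proj₂ (proj₂ (edge′ a b ab))

-- The Ramsey argument

lookup-All : ∀ {A : Set} {P : A → Set} {xs : List A} → All P xs → ∀ i → P (lookup xs i)
lookup-All (p ∷ ps) zero    = p
lookup-All (p ∷ ps) (suc i) = lookup-All ps i

lookup-AllPairs : ∀ {A : Set} {R : A → A → Set} {xs : List A} → AllPairs R xs →
                  ∀ i j → i 𝔽.< j → R (lookup xs i) (lookup xs j)
lookup-AllPairs (p ∷ ps) zero    (suc j) _         = lookup-All p j
lookup-AllPairs (p ∷ ps) (suc i) (suc j) (s≤s i<j) = lookup-AllPairs ps i j i<j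

∩-mono : (Y R R′ : Sub N) → (∀ y → Y y ≡ true → R y ≡ true → R′ y ≡ true) → # (Y ∩ R) ≤ # (Y ∩ R′)
∩-mono Y R R′ h = #-mono (Y ∩ R) (Y ∩ R′)
  (λ y p → ∧-intro (∧-elimˡ {Y y} p) (h y (∧-elimˡ {Y y} p) (∧-elimʳ {Y y} p)))

-- The number of internal nodes of the complete binary tree of depth `h`, each of which stands for
-- one red step.
treeCost : ℕ → ℕ
treeCost zero    = 0
treeCost (suc h) = suc (treeCost h + treeCost h)

SparseBy : (Fin N → Fin N → Bool) → ℕ → Sub N → Sub N → Set
SparseBy R E X Y = ∀ x → X x ≡ true → E * # (Y ∩ R x) ≤ # Y

-- `SparseBy R E X Y` passes to subsets of `X` but not of `Y`. Once `A` has been cut into the sets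
-- `Xs`, sparsity must therefore be turned around before `B` is cut further. By double counting at
-- most a share `1 / G` of `B` is dense towards a given `X`, at the price of weakening `G * E` to
-- `E`.
prune : (R : Fin N → Fin N → Bool) → (∀ x y → R x y ≡ R y x) →
  (G E : ℕ) → .⦃ NonZero E ⦄ → (B : Sub N) (Xs : List (Sub N)) →
  All (λ X → 0 < # X × SparseBy R (G * E) X B) Xs →
  Σ (Sub N) λ B′ → B′ ⊆ B × G * # B ≤ G * # B′ + length Xs * # B × All (SparseBy R E B′) Xs
prune R R-sym G E B [] [] = B , (λ _ p → p) , m≤m+n _ _ , []
prune {N} R R-sym G E B (X ∷ Xs) ((X>0 , sp) ∷ ps) with prune R R-sym G E B Xs ps
... | B″ , B″⊆B , size , sps = B′ , (λ y p → B″⊆B y (∧-elimˡ p)) , size′ ,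
      (λ y p → ≮ᴮ⇒≥ (not-elim (∧-elimʳ {B″ y} p))) ∷ All.map (λ s y p → s y (∧-elimˡ p)) sps
  where
  bad B′ : Sub N
  bad y = # X <ᴮ E * # (X ∩ R y)
  B′ y = B″ y ∧ not (bad y)
  few-bad : # (B ∩ bad) * G ≤ # B
  few-bad = *-cancelˡ-≤ E (≤-trans (≤-reflexive (trans (x∙yz≈y∙xz E (# (B ∩ bad)) G) (cong (# (B ∩ bad) *_) (*-comm E G))))
    (dense-few B (B ∩ bad) X R (G * E) (# B) E X>0 (λ _ → ∧-elimˡ)
      (λ x x∈ → ≤-trans (≤-reflexive (*-comm _ (G * E))) (≤-trans
        (*-monoʳ-≤ (G * E) (#-mono _ (B ∩ R x) (λ y p → ∧-intro (∧-elimˡ p) (trans (R-sym x y) (∧-elimʳ {B y} p)))))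
        (sp x x∈)))
      (λ y p → <⇒≤ (<ᴮ⇒< (∧-elimʳ {B y} p)))))
  size′ : G * # B ≤ G * # B′ + (# B + length Xs * # B)
  size′ = begin
    G * # B                                ≤⟨ size ⟩
    G * # B″ + L                           ≤⟨ +-monoˡ-≤ L (*-monoʳ-≤ G (#-∪ B″ B′ (B ∩ bad) λ y p → Sum.swap (Sum.map
                                                (λ q → ∧-intro (B″⊆B y p) q) (λ q → ∧-intro p (cong not q)) (true? (bad y))))) ⟩
    G * (# B′ + # (B ∩ bad)) + L           ≡⟨ cong (_+ L) (*-distribˡ-+ G (# B′) _) ⟩
    G * # B′ + G * # (B ∩ bad) + L         ≤⟨ +-monoˡ-≤ L (+-monoʳ-≤ (G * # B′) (≤-trans (≤-reflexive (*-comm G _)) few-bad)) ⟩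
    G * # B′ + # B + L                     ≡⟨ +-assoc (G * # B′) (# B) L ⟩
    G * # B′ + (# B + L)                   ∎
    where
    open ≤-Reasoning
    L = length Xs * # B

module Ramsey {n N K : ℕ} ⦃ K≢0 : NonZero K ⦄ (H : EOGraph n)
  (ℓ : Fin N → Fin N → Fin K) (ℓ-sym : ∀ x y → ℓ x y ≡ ℓ y x) (ℓ-diag : ∀ x → toℕ (ℓ x x) ≡ 0)
  (Q : ℕ) (many : PseudoRandom.MostHaveManyNeighbours ℓ Q) (few : PseudoRandom.MostHaveFewNeighbours ℓ Q)
  (g e E M S₀ ω : ℕ) ⦃ E≢0 : NonZero E ⦄ (τ : ℕ → ℕ) (τ-suc : ∀ n → τ (suc n) ≡ 16 * τ n)
  (8K≤τ : ∀ n → 8 * K ≤ τ n) (τ≤E : ∀ i → i ≤ 2 ^ g → τ i ≤ E)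
  (n≤G : n ≤ 2 ^ g) (e≡ : 2 ^ e ≡ 2 ^ g * E) (2K≤ : 2 * K ≤ 2 ^ e)
  (M≥ : n * n + 3 ≤ M) (K≥ : M ^ (treeCost g + 1) ≤ K)
  (S₀-big : 2 ^ g * Q < S₀ * S₀) (ω≤ : ω * (8 * K) ^ n ≤ S₀)
  (budget : 2 ^ g * (Q + 8 * K * (2 ^ g * (E * Q))) < ω * ω)
  where

  open LabelledGraph ℓ ℓ-sym ℓ-diag
  open PseudoRandom ℓ

  G : ℕ
  G = 2 ^ g

  -- The size that suffices to grow a tree of depth `h`: `2 ^ (e * n)` pays for the greedy red
  -- embedding, `G` for the smaller side of a sparse pair, and 2 for pruning the other side.
  S : ℕ → ℕ
  S zero    = S₀
  S (suc h) = 2 * G * S h * 2 ^ (e * n)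

  module _ (χ : Colouring graph) where

    opaque
      within : (lo w : ℕ) → Fin N → Fin N → Bool
      within lo w x y = does ((lo ≤? lab x y) ×-dec (lab x y <? lo + w))

      within⇒ : ∀ {lo w} x y → within lo w x y ≡ true → lo ≤ lab x y × lab x y < lo + w
      within⇒ {lo} {w} x y = does⇒ ((lo ≤? lab x y) ×-dec (lab x y <? lo + w))

      ⇒within : ∀ {lo w} x y → lo ≤ lab x y → lab x y < lo + w → within lo w x y ≡ true
      ⇒within {lo} {w} x y p q = ⇒does ((lo ≤? lab x y) ×-dec (lab x y <? lo + w)) (p , q)

      within-sym : ∀ {lo w} x y → within lo w x y ≡ within lo w y x
      within-sym {lo} {w} x y = cong (λ c → does ((lo ≤? toℕ c) ×-dec (toℕ c <? lo + w))) (ℓ-sym x y)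

    redIn : (lo w : ℕ) → Fin N → Fin N → Bool
    redIn lo w x y = within lo w x y ∧ col χ x y

    redIn-sym : ∀ {lo w} x y → redIn lo w x y ≡ redIn lo w y x
    redIn-sym x y = cong₂ _∧_ (within-sym x y) (col-sym χ x y)

    record Inside (lo′ w′ lo w : ℕ) : Set where
      constructor _,_
      field
        starts : lo ≤ lo′
        ends   : lo′ + w′ ≤ lo + w
    open Inside

    redIn-mono : ∀ {lo′ w′ lo w} → Inside lo′ w′ lo w → ∀ x y → redIn lo′ w′ x y ≡ true → redIn lo w x y ≡ true
    redIn-mono (p , q) x y r with s , t ← within⇒ x y (∧-elimˡ r) =
      ∧-intro (⇒within x y (≤-trans p s) (<-≤-trans t q)) (∧-elimʳ {within _ _ x y} r)

    Inside-trans : ∀ {lo″ w″ lo′ w′ lo w} → Inside lo″ w″ lo′ w′ → Inside lo′ w′ lo w → Inside lo″ w″ lo w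
    Inside-trans (p , q) (r , s) = ≤-trans r p , ≤-trans q s

    Sparse : ℕ → (lo w : ℕ) → Sub N → Sub N → Set
    Sparse D lo w = SparseBy (redIn lo w) D

    Sparse-mono : ∀ D {lo′ w′ lo w} X Y → Inside lo′ w′ lo w → Sparse D lo w X Y → Sparse D lo′ w′ X Y
    Sparse-mono D {lo′} {w′} {lo} {w} X Y i s x p = ≤-trans
      (*-monoʳ-≤ D (∩-mono Y (redIn lo′ w′ x) (redIn lo w x) (λ y _ → redIn-mono i x y))) (s x p)

    K≥3 : 3 ≤ K
    K≥3 = ≤-trans (≤-trans (m≤n+m 3 (n * n)) M≥) (≤-trans M≤ K≥)
      where
      M≤ : M ≤ M ^ (treeCost g + 1)
      M≤ = ≤-trans (≤-reflexive (sym (*-identityʳ M)))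
        (^-monoʳ-≤ M ⦃ >-nonZero (≤-trans (s≤s z≤n) (≤-trans (m≤n+m 3 (n * n)) M≥)) ⦄ (m≤n+m 1 (treeCost g)))

    one : Fin K
    one = fromℕ< (≤-trans (s≤s (s≤s z≤n)) K≥3)

    lab-one : ∀ x y → has one x y ≡ true → lab x y ≡ 1
    lab-one x y p = trans (cong toℕ (has⇒≡ x y p)) (𝔽.toℕ-fromℕ< _)

    child : (lo w : ℕ) (a b : Fin n) → ℕ
    child lo w a b = lo + (2 + position H a b) * w

    child-end : ∀ lo w a b → child lo w a b + w ≡ lo + (3 + position H a b) * w
    child-end lo w a b = lemma lo (position H a b) w
      where
      lemma : ∀ l p w → l + (2 + p) * w + w ≡ l + (3 + p) * w
      lemma = solve-∀

    child-inside : ∀ lo w a b → Inside (child lo w a b) w lo (M * w)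
    child-inside lo w a b = m≤m+n lo _ , ≤-trans (≤-reflexive (child-end lo w a b))
      (+-monoʳ-≤ lo (*-monoˡ-≤ w (≤-trans (≤-trans (+-monoʳ-≤ 3 (edgesBelow≤ H _)) (≤-reflexive (+-comm 3 (n * n)))) M≥)))

    redRel : (lo w : ℕ) → Fin n → Fin n → Fin N → Fin N → Bool
    redRel lo w a b x y = if adj H a b then redIn (child lo w a b) w x y else has one x y

    redRel-edge : ∀ lo w a b x y → adj H a b ≡ true → redRel lo w a b x y ≡ redIn (child lo w a b) w x y
    redRel-edge lo w a b x y p = cong (if_then redIn (child lo w a b) w x y else has one x y) p

    redRel-non-edge : ∀ lo w a b x y → adj H a b ≡ false → redRel lo w a b x y ≡ has one x y
    redRel-non-edge lo w a b x y p = cong (if_then redIn (child lo w a b) w x y else has one x y) p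

    red-copy : ∀ U lo w → 0 < w → Transversal n (redRel lo w) (λ _ → U) → MonoInducedCopy H graph χ
    red-copy U lo w w>0 (f , _ , rel) = monoInducedCopy H χ f lo w w>0 true
      (λ a b lt ab → let r = trans (sym (redRel-edge lo w a b (f a) (f b) ab)) (rel a b lt)
                         p , q = within⇒ (f a) (f b) (∧-elimˡ r) in
        p , <-≤-trans q (≤-reflexive (child-end lo w a b)) , ∧-elimʳ {within _ _ (f a) (f b)} r)
      (λ a b lt ab → lab-one (f a) (f b) (trans (sym (redRel-non-edge lo w a b (f a) (f b) ab)) (rel a b lt)))

    Step : (s : ℕ) (U : Sub N) (lo w : ℕ) → Set
    Step s U lo w = ∃ λ lo′ → Inside lo′ w lo (M * w) × ∃₂ λ A B → A ⊆ U × B ⊆ U ×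
      s ≤ G * # A × s ≤ # B × Sparse (G * E) lo′ w A B

    sparse-step : ∀ {s U} lo w → S₀ ≤ s → SparsePair n G e s (redRel lo w) (λ _ → U) → Step s U lo w
    sparse-step {s} lo w S₀≤s (a , b , _ , A , B , A⊆U , B⊆U , sA , sB , sp) with true? (adj H a b)
    ... | inj₁ ab = child lo w a b , child-inside lo w a b , A , B , A⊆U , B⊆U , sA , sB ,
      λ x p → ≤-trans (*-mono-≤ (≤-reflexive (sym e≡))
        (∩-mono B (redIn (child lo w a b) w x) (redRel lo w a b x) λ y _ q → trans (redRel-edge lo w a b x y ab) q)) (<⇒≤ (sp x p))
    -- A non-edge cannot yield a sparse pair: label 1 would have density below `1 / (2 * K)` from
    -- every vertex of `A` into `B`, which pseudo-randomness allows only if `# A * # B ≤ Q`, and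
    -- both sets are too large for that.
    ... | inj₂ ab = ⊥-elim (<⇒≱ S₀-big (begin
        S₀ * S₀           ≤⟨ *-mono-≤ S₀≤s S₀≤s ⟩
        s * s             ≤⟨ *-mono-≤ sA sB ⟩
        G * # A * # B     ≡⟨ *-assoc G (# A) (# B) ⟩
        G * (# A * # B)   ≤⟨ *-monoʳ-≤ G (many one A B λ x p → ≤-<-trans
                              (*-mono-≤ 2K≤ (∩-mono B (has one x) (redRel lo w a b x) λ y _ q →
                                 trans (redRel-non-edge lo w a b x y ab) q)) (sp x p)) ⟩
        G * Q             ∎))
      where open ≤-Reasoning

    S₀>0 : 0 < S₀
    S₀>0 = n≢0⇒n>0 λ p → n≮0 (subst (λ z → G * Q < z * z) p S₀-big)

    G>0 : 0 < G
    G>0 = m^n>0 2 g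

    red-step : ∀ s U lo w → 0 < w → S₀ ≤ s → s * 2 ^ (e * n) ≤ # U → MonoInducedCopy H graph χ ⊎ Step s U lo w
    red-step s U lo w w>0 S₀≤s size =
      Sum.map (red-copy U lo w w>0) (sparse-step lo w S₀≤s)
        (greedy n G e s n≤G (≤-trans S₀>0 S₀≤s) (redRel lo w) (λ _ → U) (λ _ → size))

    S-mono : ∀ h → S₀ ≤ S h
    S-mono zero    = ≤-refl
    S-mono (suc h) = ≤-trans (S-mono h) (≤-trans (m≤n*m (S h) (2 * G) ⦃ m*n≢0 2 G ⦃ _ ⦄ ⦃ >-nonZero G>0 ⦄ ⦄)
                                                 (m≤m*n _ (2 ^ (e * n)) ⦃ m^n≢0 2 (e * n) ⦄))

    -- `l` is the number of factors `M` of interval length to be left for later use; growing depth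
    -- `h` spends `treeCost h` more. Sparsity is asked only from earlier to later sets of the list,
    -- the direction in which vertices are embedded.
    Tree : (h l lo : ℕ) (U : Sub N) → Set
    Tree h l lo U = ∃ λ lo′ → Inside lo′ (M ^ l) lo (M ^ (treeCost h + l)) × Σ (List (Sub N)) λ Xs →
      length Xs ≡ 2 ^ h × AllPairs (Sparse E lo′ (M ^ l)) Xs × All (λ X → X ⊆ U × S₀ ≤ # X) Xs

    M>0 : 0 < M
    M>0 = ≤-trans (s≤s z≤n) (≤-trans (m≤n+m 3 (n * n)) M≥)

    -- The tree in `B` grows inside the interval left over by the tree in `A`, since sparsity in an
    -- interval passes to its subintervals. After pruning, sparsity runs from `B′` to the sets found
    -- in `A`, hence the order `Bs ++ As`.
    glue : ∀ h l lo U → 2 ^ suc h ≤ G →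
      (∀ l lo U → S h ≤ # U → MonoInducedCopy H graph χ ⊎ Tree h l lo U) →
      Step (2 * G * S h) U lo (M ^ (treeCost h + (treeCost h + l))) →
      MonoInducedCopy H graph χ ⊎ Tree (suc h) l lo U
    glue h l lo U fits ih (lo₁ , in₁ , A , B , A⊆U , B⊆U , sA , sB , sp) = onA (ih (treeCost h + l) lo₁ A A-big)
      where
      A-big : S h ≤ # A
      A-big = *-cancelˡ-≤ G ⦃ >-nonZero G>0 ⦄ (≤-trans (≤-trans (m≤n*m _ 2) (≤-reflexive (sym (*-assoc 2 G (S h))))) sA)
      total : M * M ^ (treeCost h + (treeCost h + l)) ≡ M ^ (treeCost (suc h) + l)
      total = cong (λ z → M * M ^ z) (sym (+-assoc (treeCost h) (treeCost h) l))
      onA : MonoInducedCopy H graph χ ⊎ Tree h (treeCost h + l) lo₁ A → MonoInducedCopy H graph χ ⊎ Tree (suc h) l lo U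
      onA (inj₁ copy) = inj₁ copy
      onA (inj₂ (lo₂ , in₂ , As , lenA , pairsA , subsA)) = onB (ih l lo₂ B′ B′-big)
        where
        pruned = prune (redIn lo₂ (M ^ (treeCost h + l))) redIn-sym G E B As
          (All.map (λ { {X} (X⊆A , X-big) → ≤-trans S₀>0 X-big ,
             λ x p → Sparse-mono (G * E) A B in₂ sp x (X⊆A x p) }) subsA)
        B′ = proj₁ pruned
        B′⊆B = proj₁ (proj₂ pruned)
        -- The `2 ^ h` sets found in `A` each remove at most a share `1 / G` of `B`, and
        -- `2 * 2 ^ h ≤ G`.
        half : # B ≤ 2 * # B′
        half = *-cancelˡ-≤ G ⦃ >-nonZero G>0 ⦄ (+-cancelʳ-≤ (G * # B) _ _ (begin
          G * # B + G * # B                         ≤⟨ +-mono-≤ (proj₁ (proj₂ (proj₂ pruned))) (proj₁ (proj₂ (proj₂ pruned))) ⟩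
          (G * # B′ + length As * # B) + (G * # B′ + length As * # B) ≡⟨ cong (λ z → (G * # B′ + z * # B) + (G * # B′ + z * # B)) lenA ⟩
          (G * # B′ + 2 ^ h * # B) + (G * # B′ + 2 ^ h * # B) ≡⟨ lemma G (# B′) (2 ^ h) (# B) ⟩
          G * (2 * # B′) + 2 * 2 ^ h * # B          ≤⟨ +-monoʳ-≤ (G * (2 * # B′)) (*-monoˡ-≤ (# B) fits) ⟩
          G * (2 * # B′) + G * # B                  ∎))
          where
          open ≤-Reasoning
          lemma : ∀ g b t c → (g * b + t * c) + (g * b + t * c) ≡ g * (2 * b) + 2 * t * c
          lemma = solve-∀
        B′-big : S h ≤ # B′
        B′-big = *-cancelˡ-≤ 2 (≤-trans (≤-trans (*-monoˡ-≤ (S h) (m≤m*n 2 G ⦃ >-nonZero G>0 ⦄)) sB) half)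
        onB : MonoInducedCopy H graph χ ⊎ Tree h l lo₂ B′ → MonoInducedCopy H graph χ ⊎ Tree (suc h) l lo U
        onB (inj₁ copy) = inj₁ copy
        onB (inj₂ (lo₃ , in₃ , Bs , lenB , pairsB , subsB)) = inj₂
          ( lo₃
          , Inside-trans in₃ (Inside-trans in₂ (subst (Inside lo₁ _ lo) total in₁))
          , Bs ++ As
          , trans (length-++ Bs) (trans (cong₂ _+_ lenB lenA) (cong (2 ^ h +_) (sym (+-identityʳ (2 ^ h)))))
          , AllPairs.++⁺ pairsB (AllPairs.map (λ {X} {Y} → Sparse-mono E X Y in₃) pairsA)
              (All.map (λ { {X} (X⊆B′ , _) → All.map (λ {Y} s → λ x p → Sparse-mono E B′ Y in₃ s x (X⊆B′ x p))
                 (proj₂ (proj₂ (proj₂ pruned))) }) subsB)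
          , All.++⁺ (All.map (λ (s , t) → (λ x p → B⊆U x (B′⊆B x (s x p))) , t) subsB)
                    (All.map (λ (s , t) → (λ x p → A⊆U x (s x p)) , t) subsA) )

    tree : ∀ h l lo U → 2 ^ h ≤ G → S h ≤ # U → MonoInducedCopy H graph χ ⊎ Tree h l lo U
    tree zero l lo U _ size = inj₂ (lo , (≤-refl , ≤-refl) , U ∷ [] , refl , [] ∷ [] , ((λ _ p → p) , size) ∷ [])
    tree (suc h) l lo U fits size = Sum.[ inj₁
      , glue h l lo U fits (λ l′ lo′ U′ → tree h l′ lo′ U′ (≤-trans (m≤n*m (2 ^ h) 2) fits)) ]
      (red-step (2 * G * S h) U lo w (m^n>0 M ⦃ >-nonZero M>0 ⦄ (treeCost h + (treeCost h + l)))
        (≤-trans (S-mono h) (m≤n*m (S h) (2 * G) ⦃ m*n≢0 2 G ⦃ _ ⦄ ⦃ >-nonZero G>0 ⦄ ⦄)) size)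
      where w = M ^ (treeCost h + (treeCost h + l))

    -- In an interval of length `M ^ 1` the subintervals have width 1, so every edge of `H` has a
    -- single prescribed label, and the forbidden pairs are the red ones with that label. At
    -- non-edges nothing is forbidden, because the colour is irrelevant there.
    blue-copy : ∀ U → Tree g 1 0 U → MonoInducedCopy H graph χ
    blue-copy U (lo , hi , Xs , len , pairs , subs) =
      monoInducedCopy H χ f lo 1 ≤-refl false
        (λ a b lt ab →
          let l≡ = trans (cong toℕ (has⇒≡ (f a) (f b) (∧-elimˡ (rel a b lt)))) (label-edge a b ab) in
          ≤-reflexive (sym l≡) , ≤-trans (s≤s (≤-reflexive l≡)) (≤-reflexive (trans (+-comm 1 _) (child-end lo 1 a b))) ,
          blue a b ab (∧-elimˡ (rel a b lt)) (not-elim (∧-elimʳ {has (label a b) (f a) (f b)} (rel a b lt))))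
        (λ a b lt ab → lab-one (f a) (f b)
          (trans (cong (λ c → has c (f a) (f b)) (sym (label-non-edge a b ab))) (∧-elimˡ (rel a b lt))))
      where
      hi≤K : lo + M * 1 ≤ K
      hi≤K = ≤-trans (ends hi) K≥
      blueLabel : Fin n → Fin n → Fin K
      blueLabel a b = fromℕ< {child lo 1 a b} (≤-trans (≤-trans (≤-reflexive (+-comm 1 _)) (ends (child-inside lo 1 a b))) hi≤K)
      label : Fin n → Fin n → Fin K
      label a b = if adj H a b then blueLabel a b else one
      label-edge : ∀ a b → adj H a b ≡ true → toℕ (label a b) ≡ child lo 1 a b
      label-edge a b ab = trans (cong (λ t → toℕ (if t then blueLabel a b else one)) ab) (𝔽.toℕ-fromℕ< _)
      label-non-edge : ∀ a b → adj H a b ≡ false → label a b ≡ one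
      label-non-edge a b ab = cong (if_then blueLabel a b else one) ab
      F : Fin n → Fin n → Fin N → Fin N → Bool
      F a b x y = adj H a b ∧ (has (label a b) x y ∧ col χ x y)
      n≤len : n ≤ length Xs
      n≤len = ≤-trans n≤G (≤-reflexive (sym len))
      ι : Fin n → Fin (length Xs)
      ι = λ i → 𝔽.inject≤ i n≤len
      W : Fin n → Sub N
      W a = lookup Xs (ι a)
      sparse : ∀ a b → a 𝔽.< b → ∀ x → W a x ≡ true → τ n * # (W b ∩ F a b x) ≤ # (W b)
      sparse a b a<b x p = ≤-trans
        (*-mono-≤ (τ≤E n n≤G) (∩-mono (W b) (F a b x) (redIn lo (M ^ 1) x) λ y _ q → F⇒red y q))
        (lookup-AllPairs pairs (ι a) (ι b)
          (subst₂ _<_ (sym (𝔽.toℕ-inject≤ a n≤len)) (sym (𝔽.toℕ-inject≤ b n≤len)) a<b) x p)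
        where
        F⇒red : ∀ y → F a b x y ≡ true → redIn lo (M ^ 1) x y ≡ true
        F⇒red y q = ∧-intro (⇒within x y
            (≤-trans (starts (child-inside lo 1 a b)) (≤-reflexive (sym l≡)))
            (≤-trans (≤-reflexive (trans (cong suc l≡) (+-comm 1 _))) (ends (child-inside lo 1 a b))))
          (∧-elimʳ {has (label a b) x y} (∧-elimʳ {adj H a b} q))
          where
          l≡ : lab x y ≡ child lo 1 a b
          l≡ = trans (cong toℕ (has⇒≡ x y (∧-elimˡ (∧-elimʳ {adj H a b} q)))) (label-edge a b (∧-elimˡ q))
      found = BlueEmbedding.embed-avoiding ℓ Q many few G ω E τ τ-suc 8K≤τ τ≤E budget n n≤G label F W
        (λ b → ≤-trans ω≤ (proj₂ (lookup-All subs (ι b)))) sparse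
      f = proj₁ found
      rel = proj₂ (proj₂ found)
      blue : ∀ a b → adj H a b ≡ true → has (label a b) (f a) (f b) ≡ true → F a b (f a) (f b) ≡ false →
             col χ (f a) (f b) ≡ false
      blue a b ab h p = ∧-falseʳ h (∧-falseʳ ab p)

    full : Sub N
    full _ = true

    copy : S g ≤ N → MonoInducedCopy H graph χ
    copy S≤N = Sum.[ (λ c → c) , blue-copy full ]
      -- The argument 1 reserves one factor `M` for the blue copy; with the `treeCost g` red steps
      -- this makes the exponent `2 ^ g` of `M`.
      (tree g 1 0 full ≤-refl (≤-trans S≤N (≤-reflexive (sym (#-full N)))))
      where
      #-full : ∀ N → # {N} (λ _ → true) ≡ N
      #-full N = trans (#-sum _) (sum-ones N)

-- The second moment of label degrees

module Chebyshev {N K : ℕ} (ℓ : Fin N → Fin N → Fin K) (P β : ℕ) (N≡ : N ≡ P * K)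
  (same : Fin N → Sub N) where
  open PseudoRandom ℓ

  module _
    (degree : ∀ c v → P ≤ # (λ u → has c u v))
    (codegree : ∀ c v v′ → K * # (λ u → has c u v ∧ has c u v′) ≤ P + ⟦ same v v′ ⟧ * (P * K))
    (same-few : ∀ v → # (same v) ≤ β)
    where

    module _ (c : Fin K) (S : Sub N) where

      s : ℕ
      s = # S

      d : Fin N → ℕ
      d u = # (S ∩ has c u)

      first-moment : s * P ≤ sum d
      first-moment = begin
        s * P                                     ≤⟨ sum-in≥ S (λ v → # (λ u → has c u v)) P (λ v _ → degree c v) ⟩
        sum (λ v → ⟦ S v ⟧ * # (λ u → has c u v)) ≡⟨ double-count (λ _ → true) S (has c) ⟨
        sum (λ u → 1 * d u)                       ≡⟨ sum-cong-≗ (λ u → *-identityˡ (d u)) ⟩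
        sum d                                     ∎
        where open ≤-Reasoning

      d-sum : ∀ u → d u ≡ sum (λ v → ⟦ S v ⟧ * ⟦ has c u v ⟧)
      d-sum u = trans (#-sum _) (sum-cong-≗ (λ v → ⟦⟧-∧ (S v) (has c u v)))

      square-expand : ∀ u → d u * d u ≡ sum (λ v → sum (λ v′ → ⟦ S v ⟧ * (⟦ S v′ ⟧ * ⟦ has c u v ∧ has c u v′ ⟧)))
      square-expand u = begin
        d u * d u
          ≡⟨ cong₂ _*_ (d-sum u) (d-sum u) ⟩
        sum f * sum f
          ≡⟨ *-distribʳ-sum (sum f) f ⟩
        sum (λ v → f v * sum f)
          ≡⟨ sum-cong-≗ (λ v → *-distribˡ-sum (f v) f) ⟩
        sum (λ v → sum (λ v′ → f v * f v′))
          ≡⟨ sum-cong-≗ (λ v → sum-cong-≗ (λ v′ → trans (shuffle ⟦ S v ⟧ ⟦ has c u v ⟧ ⟦ S v′ ⟧ ⟦ has c u v′ ⟧)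
               (cong (λ z → ⟦ S v ⟧ * (⟦ S v′ ⟧ * z)) (sym (⟦⟧-∧ (has c u v) (has c u v′)))))) ⟩
        sum (λ v → sum (λ v′ → ⟦ S v ⟧ * (⟦ S v′ ⟧ * ⟦ has c u v ∧ has c u v′ ⟧))) ∎
        where
        open ≡-Reasoning
        f : Fin N → ℕ
        f v = ⟦ S v ⟧ * ⟦ has c u v ⟧
        shuffle : ∀ a b x y → a * b * (x * y) ≡ a * (x * (b * y))
        shuffle = solve-∀

      second-moment-pairs : sum (λ u → d u * d u) ≡
        sum (λ v → ⟦ S v ⟧ * sum (λ v′ → ⟦ S v′ ⟧ * # (λ u → has c u v ∧ has c u v′)))
      second-moment-pairs = begin
        sum (λ u → d u * d u)
          ≡⟨ sum-cong-≗ square-expand ⟩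
        sum (λ u → sum (λ v → sum (λ v′ → t u v v′)))
          ≡⟨ ∑-comm (λ u v → sum (t u v)) ⟩
        sum (λ v → sum (λ u → sum (λ v′ → t u v v′)))
          ≡⟨ sum-cong-≗ (λ v → ∑-comm (λ u v′ → t u v v′)) ⟩
        sum (λ v → sum (λ v′ → sum (λ u → t u v v′)))
          ≡⟨ sum-cong-≗ (λ v → sum-cong-≗ (λ v′ → pull v v′)) ⟩
        sum (λ v → sum (λ v′ → ⟦ S v ⟧ * (⟦ S v′ ⟧ * # (λ u → has c u v ∧ has c u v′))))
          ≡⟨ sum-cong-≗ (λ v → sym (*-distribˡ-sum ⟦ S v ⟧ (λ v′ → ⟦ S v′ ⟧ * # (λ u → has c u v ∧ has c u v′)))) ⟩
        sum (λ v → ⟦ S v ⟧ * sum (λ v′ → ⟦ S v′ ⟧ * # (λ u → has c u v ∧ has c u v′))) ∎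
        where
        open ≡-Reasoning
        t : Fin N → Fin N → Fin N → ℕ
        t u v v′ = ⟦ S v ⟧ * (⟦ S v′ ⟧ * ⟦ has c u v ∧ has c u v′ ⟧)
        pull : ∀ v v′ → sum (λ u → t u v v′) ≡ ⟦ S v ⟧ * (⟦ S v′ ⟧ * # (λ u → has c u v ∧ has c u v′))
        pull v v′ = sym (trans (cong (λ z → ⟦ S v ⟧ * (⟦ S v′ ⟧ * z)) (#-sum _))
          (trans (cong (⟦ S v ⟧ *_) (*-distribˡ-sum ⟦ S v′ ⟧ (λ u → ⟦ has c u v ∧ has c u v′ ⟧)))
                 (*-distribˡ-sum ⟦ S v ⟧ (λ u → ⟦ S v′ ⟧ * ⟦ has c u v ∧ has c u v′ ⟧))))

      -- Expanding the square counts pairs in `S` by codegree. A generic pair has at most the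
      -- codegree `P / K` of independent labels; the at most `β` partners of a vertex under `same`
      -- are charged an extra `P` each.
      second-moment : K * sum (λ u → d u * d u) ≤ s * (s * P + β * (P * K))
      second-moment = begin
        K * sum (λ u → d u * d u)
          ≡⟨ cong (K *_) second-moment-pairs ⟩
        K * sum (λ v → ⟦ S v ⟧ * sum (λ v′ → ⟦ S v′ ⟧ * # (λ u → has c u v ∧ has c u v′)))
          ≡⟨ *-distribˡ-sum K (λ v → ⟦ S v ⟧ * sum (λ v′ → ⟦ S v′ ⟧ * # (λ u → has c u v ∧ has c u v′))) ⟩
        sum (λ v → K * (⟦ S v ⟧ * sum (λ v′ → ⟦ S v′ ⟧ * # (λ u → has c u v ∧ has c u v′))))
          ≡⟨ sum-cong-≗ (λ v → x∙yz≈y∙xz K ⟦ S v ⟧ _) ⟩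
        sum (λ v → ⟦ S v ⟧ * (K * sum (λ v′ → ⟦ S v′ ⟧ * # (λ u → has c u v ∧ has c u v′))))
          ≤⟨ sum-in S (λ v → K * sum (λ v′ → ⟦ S v′ ⟧ * # (λ u → has c u v ∧ has c u v′))) (s * P + β * (P * K)) (λ v _ → inner v) ⟩
        s * (s * P + β * (P * K)) ∎
        where
        open ≤-Reasoning
        inner : ∀ v → K * sum (λ v′ → ⟦ S v′ ⟧ * # (λ u → has c u v ∧ has c u v′)) ≤ s * P + β * (P * K)
        inner v = begin
          K * sum (λ v′ → ⟦ S v′ ⟧ * # (λ u → has c u v ∧ has c u v′))
            ≡⟨ *-distribˡ-sum K (λ v′ → ⟦ S v′ ⟧ * # (λ u → has c u v ∧ has c u v′)) ⟩
          sum (λ v′ → K * (⟦ S v′ ⟧ * # (λ u → has c u v ∧ has c u v′)))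
            ≤⟨ sum-mono _ _ (λ v′ → pt (S v′) (same v v′) (codegree c v v′)) ⟩
          sum (λ v′ → ⟦ S v′ ⟧ * P + ⟦ same v v′ ⟧ * (P * K))
            ≡⟨ ∑-distrib-+ (λ v′ → ⟦ S v′ ⟧ * P) (λ v′ → ⟦ same v v′ ⟧ * (P * K)) ⟩
          sum (λ v′ → ⟦ S v′ ⟧ * P) + sum (λ v′ → ⟦ same v v′ ⟧ * (P * K))
            ≡⟨ cong₂ _+_ (trans (sym (*-distribʳ-sum P (λ v′ → ⟦ S v′ ⟧))) (cong (_* P) (sym (#-sum S))))
                 (trans (sym (*-distribʳ-sum (P * K) (λ v′ → ⟦ same v v′ ⟧))) (cong (_* (P * K)) (sym (#-sum (same v))))) ⟩
          s * P + # (same v) * (P * K)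
            ≤⟨ +-monoʳ-≤ (s * P) (*-monoˡ-≤ (P * K) (same-few v)) ⟩
          s * P + β * (P * K) ∎
          where
          pt : ∀ b b′ {m} → K * m ≤ P + ⟦ b′ ⟧ * (P * K) → K * (⟦ b ⟧ * m) ≤ ⟦ b ⟧ * P + ⟦ b′ ⟧ * (P * K)
          pt true b′ {m} h = ≤-trans (≤-reflexive (cong (K *_) (+-identityʳ m)))
            (≤-trans h (≤-reflexive (cong (_+ ⟦ b′ ⟧ * (P * K)) (sym (+-identityʳ P)))))
          pt false b′ h = ≤-trans (≤-reflexive (*-zeroʳ K)) z≤n

      two-squares : ∀ a b w → w + a ≤ b ⊎ w + b ≤ a → 2 * (a * b) + w * w ≤ a * a + b * b
      two-squares a b w h with h
      ... | inj₁ p with r , refl ← m≤n⇒∃[o]m+o≡n p = ≤-trans (m≤m+n _ (2 * w * r + r * r)) (≤-reflexive (lemma a w r))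
        where
        lemma : ∀ a w r → 2 * (a * (w + a + r)) + w * w + (2 * w * r + r * r) ≡ a * a + (w + a + r) * (w + a + r)
        lemma = solve-∀
      ... | inj₂ p with r , refl ← m≤n⇒∃[o]m+o≡n p = ≤-trans (m≤m+n _ (2 * w * r + r * r)) (≤-reflexive (lemma b w r))
        where
        lemma : ∀ b w r → 2 * ((w + b + r) * b) + w * w + (2 * w * r + r * r) ≡ (w + b + r) * (w + b + r) + b * b
        lemma = solve-∀

      two-squares₀ : ∀ a b → 2 * (a * b) ≤ a * a + b * b
      two-squares₀ a b = ≤-trans (≤-reflexive (sym (+-identityʳ _)))
        (two-squares a b 0 (Sum.swap (≤-total b a)))

      -- Chebyshev's inequality: the sum of `(T * K * d u - T * s)²` over all `u` is at most
      -- `T * T * (K * N * β * s)`, because the main terms of both moments cancel when `N = P * K`.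
      -- To avoid subtraction, a lower bound for the cross term is added on both sides.
      deviation : ∀ (A : Sub N) T w →
        (∀ u → A u ≡ true → w + T * (K * d u) ≤ T * s ⊎ w + T * s ≤ T * (K * d u)) →
        # A * (w * w) ≤ T * T * (K * N * β * s)
      deviation A T w far = +-cancelˡ-≤ (2 * (T * s * (T * K * (s * P)))) _ _ (begin
        2 * (T * s * (T * K * (s * P))) + # A * (w * w)
          ≤⟨ +-monoˡ-≤ _ (*-monoʳ-≤ 2 (*-monoʳ-≤ (T * s) (*-monoʳ-≤ (T * K) first-moment))) ⟩
        2 * (T * s * (T * K * sum d)) + # A * (w * w)
          ≡⟨ cong₂ _+_ (trans (cong (2 *_) (trans (sym (*-assoc (T * s) (T * K) (sum d))) (*-distribˡ-sum (T * s * (T * K)) d)))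
                              (*-distribˡ-sum 2 (λ u → T * s * (T * K) * d u)))
                       (trans (cong (_* (w * w)) (#-sum A)) (*-distribʳ-sum (w * w) (λ u → ⟦ A u ⟧))) ⟩
        sum (λ u → 2 * (T * s * (T * K) * d u)) + sum (λ u → ⟦ A u ⟧ * (w * w))
          ≡⟨ ∑-distrib-+ (λ u → 2 * (T * s * (T * K) * d u)) (λ u → ⟦ A u ⟧ * (w * w)) ⟨
        sum (λ u → 2 * (T * s * (T * K) * d u) + ⟦ A u ⟧ * (w * w))
          ≤⟨ sum-mono _ _ pt ⟩
        sum (λ u → T * T * K * K * (d u * d u) + T * s * (T * s))
          ≡⟨ ∑-distrib-+ (λ u → T * T * K * K * (d u * d u)) (λ u → T * s * (T * s)) ⟩
        sum (λ u → T * T * K * K * (d u * d u)) + sum {N} (λ u → T * s * (T * s))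
          ≤⟨ +-mono-≤ (≤-reflexive (sym (*-distribˡ-sum (T * T * K * K) (λ u → d u * d u))))
                      (sum-const≤ {N} _ (T * s * (T * s)) (λ _ → ≤-refl)) ⟩
        T * T * K * K * sum (λ u → d u * d u) + N * (T * s * (T * s))
          ≡⟨ cong (_+ N * (T * s * (T * s))) (*-assoc (T * T * K) K _) ⟩
        T * T * K * (K * sum (λ u → d u * d u)) + N * (T * s * (T * s))
          ≤⟨ +-monoˡ-≤ _ (*-monoʳ-≤ (T * T * K) second-moment) ⟩
        T * T * K * (s * (s * P + β * (P * K))) + N * (T * s * (T * s))
          ≡⟨ cong (λ z → T * T * K * (s * (s * P + β * (P * K))) + z * (T * s * (T * s))) N≡ ⟩
        T * T * K * (s * (s * P + β * (P * K))) + P * K * (T * s * (T * s))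
          ≡⟨ final T K s P β ⟩
        2 * (T * s * (T * K * (s * P))) + T * T * (K * (P * K) * β * s)
          ≡⟨ cong (λ z → 2 * (T * s * (T * K * (s * P))) + T * T * (K * z * β * s)) N≡ ⟨
        2 * (T * s * (T * K * (s * P))) + T * T * (K * N * β * s) ∎)
        where
        open ≤-Reasoning
        final : ∀ t k s p b → t * t * k * (s * (s * p + b * (p * k))) + p * k * (t * s * (t * s))
                ≡ 2 * (t * s * (t * k * (s * p))) + t * t * (k * (p * k) * b * s)
        final = solve-∀
        lhs : ∀ t s k d → 2 * (t * s * (t * k) * d) ≡ 2 * (t * (k * d) * (t * s))
        lhs = solve-∀
        rhs : ∀ t s k d → t * (k * d) * (t * (k * d)) + t * s * (t * s) ≡ t * t * k * k * (d * d) + t * s * (t * s)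
        rhs = solve-∀
        pt : ∀ u → 2 * (T * s * (T * K) * d u) + ⟦ A u ⟧ * (w * w) ≤ T * T * K * K * (d u * d u) + T * s * (T * s)
        pt u = ≤-trans (≤-reflexive (cong (_+ ⟦ A u ⟧ * (w * w)) (lhs T s K (d u))))
                       (≤-trans (go (true? (A u))) (≤-reflexive (rhs T s K (d u))))
          where
          a b : ℕ
          a = T * (K * d u)
          b = T * s
          go : A u ≡ true ⊎ A u ≡ false → 2 * (a * b) + ⟦ A u ⟧ * (w * w) ≤ a * a + b * b
          go (inj₁ p) = ≤-trans (≤-reflexive (cong (2 * (a * b) +_) (trans (cong (λ z → ⟦ z ⟧ * (w * w)) p) (+-identityʳ (w * w)))))
                                (two-squares a b w (far u p))
          go (inj₂ p) = ≤-trans (≤-reflexive (trans (cong (λ z → 2 * (a * b) + ⟦ z ⟧ * (w * w)) p) (+-identityʳ (2 * (a * b)))))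
                                (two-squares₀ a b)

    cancel-square : ∀ a m w → a * (w * w) ≤ m * w → a * w ≤ m
    cancel-square a m zero h = ≤-trans (≤-reflexive (*-zeroʳ a)) z≤n
    cancel-square a m (suc w) h = *-cancelʳ-≤ _ _ (suc w) (≤-trans (≤-reflexive (*-assoc a (suc w) (suc w))) h)

    -- Below half of the mean, the deviation for `T = 2` is at least `# S`; the constant 4 is
    -- `T * T`.
    many : MostHaveManyNeighbours (4 * (K * N * β))
    many c A S poor = cancel-square (# A) _ (# S) (≤-trans
      (deviation c S A 2 (# S) (λ u p → inj₁ (≤-trans (+-monoʳ-≤ (# S)
        (≤-trans (≤-reflexive (sym (*-assoc 2 K _))) (<⇒≤ (poor u p)))) (≤-reflexive (cong (# S +_) (sym (+-identityʳ (# S))))))))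
      (≤-reflexive (sym (*-assoc 4 (K * N * β) (# S)))))

    -- Since `w + T * # S ≤ 2 * w`, a crowded vertex exceeds the mean by a deviation of at least
    -- `w`.
    few : MostHaveFewNeighbours (4 * (K * N * β))
    few c A S T w TS≤w crowded = cancel-square (# A) _ w (begin
      # A * (w * w)                      ≤⟨ deviation c S A T w (λ u p → inj₂ (≤-trans (+-monoʳ-≤ w TS≤w)
                                              (≤-trans (≤-reflexive (cong (w +_) (sym (+-identityʳ w)))) (<⇒≤ (crowded u p))))) ⟩
      T * T * (K * N * β * # S)          ≡⟨ shuffle T (K * N * β) (# S) ⟩
      T * (K * N * β) * (T * # S)        ≤⟨ *-mono-≤ (*-monoʳ-≤ T (m≤n*m (K * N * β) 4)) TS≤w ⟩
      T * (4 * (K * N * β)) * w          ∎)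
      where
      open ≤-Reasoning
      shuffle : ∀ t b s → t * t * (b * s) ≡ t * b * (t * s)
      shuffle = solve-∀

-- The Toeplitz labelling

sum-↑ : ∀ m n (f : Fin (m + n) → ℕ) → sum f ≡ sum (λ i → f (i ↑ˡ n)) + sum (λ j → f (m ↑ʳ j))
sum-↑ zero    n f = refl
sum-↑ (suc m) n f = trans (cong (f zero +_) (sum-↑ m n (f ∘ suc))) (sym (+-assoc (f zero) _ _))

sum-combine : ∀ m n (f : Fin (m * n) → ℕ) → sum f ≡ sum (λ i → sum (λ j → f (combine {m} {n} i j)))
sum-combine zero    n f = refl
sum-combine (suc m) n f = trans (sum-↑ n (m * n) f) (cong (sum (λ j → f (j ↑ˡ m * n)) +_) (sum-combine m n (λ i → f (n ↑ʳ i))))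

bit : Fin 2 → Bool
bit zero    = false
bit (suc _) = true

unbit : Bool → Fin 2
unbit false = zero
unbit true  = suc zero

unbit-bit : ∀ i → unbit (bit i) ≡ i
unbit-bit zero       = refl
unbit-bit (suc zero) = refl

bit-unbit : ∀ b → bit (unbit b) ≡ b
bit-unbit false = refl
bit-unbit true  = refl

decode : ∀ t → Fin (2 ^ t) → Vec Bool t
decode zero    _ = []
decode (suc t) i = let b , j = remQuot {2} (2 ^ t) i in bit b ∷ decode t j

encode : ∀ {t} → Vec Bool t → Fin (2 ^ t)
encode []      = zero
encode (b ∷ v) = combine (unbit b) (encode v)

decode-encode : ∀ {t} (v : Vec Bool t) → decode t (encode v) ≡ v
decode-encode [] = refl
decode-encode {suc t} (b ∷ v) = trans
  (cong (λ (i , j) → bit i ∷ decode t j) (𝔽.remQuot-combine (unbit b) (encode v)))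
  (cong₂ _∷_ (bit-unbit b) (decode-encode v))

encode-decode : ∀ t (i : Fin (2 ^ t)) → encode (decode t i) ≡ i
encode-decode zero    zero = refl
encode-decode (suc t) i = trans
  (cong₂ combine (unbit-bit (proj₁ (remQuot {2} (2 ^ t) i))) (encode-decode t (proj₂ (remQuot {2} (2 ^ t) i))))
  (𝔽.combine-remQuot {2} (2 ^ t) i)

decode-injective : ∀ t {i j} → decode t i ≡ decode t j → i ≡ j
decode-injective t {i} {j} p = trans (sym (encode-decode t i)) (trans (cong encode p) (encode-decode t j))

toℕ-encode-zero : ∀ t → toℕ (encode (replicate t false)) ≡ 0
toℕ-encode-zero zero    = refl
toℕ-encode-zero (suc t) = trans (𝔽.toℕ-combine (zero {1}) (encode (replicate t false)))
  (cong₂ _+_ (*-zeroʳ (2 ^ t)) (toℕ-encode-zero t))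

sumᵇ : ∀ t → (Vec Bool t → ℕ) → ℕ
sumᵇ t f = sum (λ i → f (decode t i))

sumᵇ-suc : ∀ t (f : Vec Bool (suc t) → ℕ) → sumᵇ (suc t) f ≡ sumᵇ t (λ v → f (false ∷ v) + f (true ∷ v))
sumᵇ-suc t f = begin
  sum (λ i → f (decode (suc t) i))
    ≡⟨ sum-combine 2 (2 ^ t) (λ i → f (decode (suc t) i)) ⟩
  sum {2} (λ b → sum {2 ^ t} (λ j → f (decode (suc t) (combine b j))))
    ≡⟨ sum-cong-≗ {2} (λ b → sum-cong-≗ {2 ^ t} (λ j → cong (λ (i , j) → f (bit i ∷ decode t j)) (𝔽.remQuot-combine {2} {2 ^ t} b j))) ⟩
  sum {2} (λ b → sum {2 ^ t} (λ j → f (bit b ∷ decode t j)))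
    ≡⟨ cong (sum (λ j → f (false ∷ decode t j)) +_) (+-identityʳ _) ⟩
  sum (λ j → f (false ∷ decode t j)) + sum (λ j → f (true ∷ decode t j))
    ≡⟨ ∑-distrib-+ (λ j → f (false ∷ decode t j)) (λ j → f (true ∷ decode t j)) ⟨
  sumᵇ t (λ v → f (false ∷ v) + f (true ∷ v)) ∎
  where open ≡-Reasoning

sumᵇ-cong : ∀ t {f g : Vec Bool t → ℕ} → (∀ v → f v ≡ g v) → sumᵇ t f ≡ sumᵇ t g
sumᵇ-cong t h = sum-cong-≗ (λ i → h (decode t i))

sumᵇ-one : ∀ t → sumᵇ t (λ _ → 1) ≡ 2 ^ t
sumᵇ-one t = sum-ones (2 ^ t)

sumᵇ-double : ∀ t (f : Vec Bool t → ℕ) → sumᵇ t (λ v → f v + f v) ≡ 2 * sumᵇ t f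
sumᵇ-double t f = trans (∑-distrib-+ (λ i → f (decode t i)) (λ i → f (decode t i)))
                        (cong (sumᵇ t f +_) (sym (+-identityʳ _)))

xor≡false : ∀ a b → a xor b ≡ false → a ≡ b
xor≡false false false _ = refl
xor≡false true  true  _ = refl

infixl 6 _⊕_
_⊕_ : ∀ {t} → Vec Bool t → Vec Bool t → Vec Bool t
_⊕_ = zipWith _xor_

_≡ᵛ_ : ∀ {t} → Vec Bool t → Vec Bool t → Bool
[]      ≡ᵛ []      = true
(a ∷ v) ≡ᵛ (b ∷ w) = not (a xor b) ∧ (v ≡ᵛ w)

⇒≡ᵛ : ∀ {t} (v w : Vec Bool t) → v ≡ w → v ≡ᵛ w ≡ true
⇒≡ᵛ []      .[]      refl = refl
⇒≡ᵛ (a ∷ v) .(a ∷ v) refl = ∧-intro (cong not (𝔹.xor-same a)) (⇒≡ᵛ v v refl)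

≡ᵛ⇒≡ : ∀ {t} (v w : Vec Bool t) → v ≡ᵛ w ≡ true → v ≡ w
≡ᵛ⇒≡ []      []      _ = refl
≡ᵛ⇒≡ (a ∷ v) (b ∷ w) p = cong₂ _∷_ (xor≡false a b (not-elim (∧-elimˡ p)))
  (≡ᵛ⇒≡ v w (∧-elimʳ {not (a xor b)} p))

⊕-self : ∀ {t} (v : Vec Bool t) → v ⊕ v ≡ replicate t false
⊕-self []      = refl
⊕-self (a ∷ v) = cong₂ _∷_ (𝔹.xor-same a) (⊕-self v)

⊕-comm : ∀ {t} (v w : Vec Bool t) → v ⊕ w ≡ w ⊕ v
⊕-comm = zipWith-comm 𝔹.xor-comm

⊕≡0⇒≡ : ∀ {t} (v w : Vec Bool t) → v ⊕ w ≡ replicate t false → v ≡ w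
⊕≡0⇒≡ []      []      _ = refl
⊕≡0⇒≡ (a ∷ v) (b ∷ w) p with q , r ← ∷-injective p = cong₂ _∷_ (xor≡false a b q) (⊕≡0⇒≡ v w r)

dot : ∀ {D L} → Vec Bool D → Vec Bool L → Bool
dot []      _       = false
dot (x ∷ v) []      = false
dot (x ∷ v) (c ∷ w) = (x ∧ c) xor dot v w

-- The product of z with the k × D Toeplitz matrix whose rows are the successive windows of C.
hash : ∀ {D L} k → Vec Bool D → Vec Bool L → Vec Bool k
hash zero    z C       = []
hash (suc k) z []      = false ∷ hash k z []
hash (suc k) z (c ∷ C) = dot z (c ∷ C) ∷ hash k z C

dot-⊕ : ∀ {D L} (x y : Vec Bool D) (C : Vec Bool L) → dot (x ⊕ y) C ≡ dot x C xor dot y C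
dot-⊕ []      []      C       = refl
dot-⊕ (a ∷ x) (b ∷ y) []      = refl
dot-⊕ (a ∷ x) (b ∷ y) (c ∷ C) = trans (cong (((a xor b) ∧ c) xor_) (dot-⊕ x y C))
  (solve 5 (λ a b c d e → ((a :+ b) :* c) :+ (d :+ e) := ((a :* c) :+ d) :+ ((b :* c) :+ e)) refl a b c (dot x C) (dot y C))
  where open xor-∧-Solver

hash-⊕ : ∀ {D L} k (x y : Vec Bool D) (C : Vec Bool L) → hash k (x ⊕ y) C ≡ hash k x C ⊕ hash k y C
hash-⊕ zero    x y C       = refl
hash-⊕ (suc k) x y []      = cong (false ∷_) (hash-⊕ k x y [])
hash-⊕ (suc k) x y (c ∷ C) = cong₂ _∷_ (dot-⊕ x y (c ∷ C)) (hash-⊕ k x y C)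

hash-[] : ∀ {D D′} k (x : Vec Bool D) (y : Vec Bool D′) → hash k x [] ≡ hash k y []
hash-[] zero    x y = refl
hash-[] (suc k) x y = cong (false ∷_) (hash-[] k x y)

dot-[] : ∀ {D} (x : Vec Bool D) → dot x [] ≡ false
dot-[] []      = refl
dot-[] (_ ∷ _) = refl

-- With a leading zero every window ignores its first bit, which amounts to starting one seed bit
-- later. Positions past the end of the seed count as zero.
hash-false : ∀ {D L} k (z : Vec Bool D) c (C : Vec Bool L) → hash k (false ∷ z) (c ∷ C) ≡ hash k z C
hash-false zero    z c C       = refl
hash-false (suc k) z c []      = cong₂ _∷_ (dot-[] z) (hash-[] k (false ∷ z) z)
hash-false (suc k) z c (b ∷ C) = cong (dot z (b ∷ C) ∷_) (hash-false k z b C)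

hits : ∀ {D} k L → Vec Bool D → Vec Bool k → ℕ
hits k L z t = sumᵇ L (λ C → ⟦ hash k z C ≡ᵛ t ⟧)

-- With leading entry 1, the first bit of C solves the first equation; the rest constrain only the later bits.
hits-true : ∀ {D} k j (z : Vec Bool D) (t : Vec Bool k) → hits k (k + j) (true ∷ z) t * 2 ^ k ≡ 2 ^ (k + j)
hits-true zero    j z [] = trans (*-identityʳ _) (sumᵇ-one j)
hits-true (suc k) j z (b ∷ t) = begin
  hits (suc k) (suc (k + j)) (true ∷ z) (b ∷ t) * (2 * 2 ^ k)
    ≡⟨ cong (_* (2 * 2 ^ k)) (trans (sumᵇ-suc (k + j) (λ C → ⟦ hash (suc k) (true ∷ z) C ≡ᵛ (b ∷ t) ⟧))
         (sumᵇ-cong (k + j) (λ C → split (dot z C) b (hash k (true ∷ z) C ≡ᵛ t)))) ⟩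
  hits k (k + j) (true ∷ z) t * (2 * 2 ^ k)
    ≡⟨ x∙yz≈y∙xz (hits k (k + j) (true ∷ z) t) 2 (2 ^ k) ⟩
  2 * (hits k (k + j) (true ∷ z) t * 2 ^ k)
    ≡⟨ cong (2 *_) (hits-true k j z t) ⟩
  2 * 2 ^ (k + j) ∎
  where
  open ≡-Reasoning
  split : ∀ d b r → ⟦ not (d xor b) ∧ r ⟧ + ⟦ not (not d xor b) ∧ r ⟧ ≡ ⟦ r ⟧
  split false false r = +-identityʳ _
  split false true  r = refl
  split true  false r = refl
  split true  true  r = +-identityʳ _

-- Each leading zero of `z` frees one seed bit and so doubles both sides; the first 1 is then
-- handled by `hits-true`, the remaining seed still being longer than `k`.
hits-uniform : ∀ {D} k (z : Vec Bool D) (t : Vec Bool k) → z ≢ replicate D false →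
               hits k (D + k) z t * 2 ^ k ≡ 2 ^ (D + k)
hits-uniform k [] t z≢0 = ⊥-elim (z≢0 refl)
hits-uniform {suc D} k (true ∷ z) t z≢0 =
  subst (λ L → hits k L (true ∷ z) t * 2 ^ k ≡ 2 ^ L) (+-comm k (suc D)) (hits-true k (suc D) z t)
hits-uniform {suc D} k (false ∷ z) t z≢0 = begin
  hits k (suc (D + k)) (false ∷ z) t * 2 ^ k
    ≡⟨ cong (_* 2 ^ k) (trans (sumᵇ-suc (D + k) (λ C → ⟦ hash k (false ∷ z) C ≡ᵛ t ⟧))
         (trans (sumᵇ-cong (D + k) (λ C → cong₂ _+_ (cong (λ h → ⟦ h ≡ᵛ t ⟧) (hash-false k z false C))
                                                    (cong (λ h → ⟦ h ≡ᵛ t ⟧) (hash-false k z true C))))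
                (sumᵇ-double (D + k) (λ C → ⟦ hash k z C ≡ᵛ t ⟧)))) ⟩
  2 * hits k (D + k) z t * 2 ^ k
    ≡⟨ *-assoc 2 (hits k (D + k) z t) (2 ^ k) ⟩
  2 * (hits k (D + k) z t * 2 ^ k)
    ≡⟨ cong (2 *_) (hits-uniform k z t (z≢0 ∘ cong (false ∷_))) ⟩
  2 * 2 ^ (D + k) ∎
  where open ≡-Reasoning

sum-const≥ : ∀ {n} (f : Fin n → ℕ) (u : ℕ) → (∀ i → u ≤ f i) → n * u ≤ sum f
sum-const≥ {zero}  f u h = z≤n
sum-const≥ {suc n} f u h = +-mono-≤ (h zero) (sum-const≥ (f ∘ suc) u (h ∘ suc))

unique≤1 : ∀ {n} (p : Fin n → Bool) → (∀ i j → p i ≡ true → p j ≡ true → i ≡ j) → sum (λ i → ⟦ p i ⟧) ≤ 1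
unique≤1 {zero}  p uniq = z≤n
unique≤1 {suc n} p uniq with p zero in eq
... | false = unique≤1 (p ∘ suc) (λ i j a b → 𝔽.suc-injective (uniq (suc i) (suc j) a b))
... | true  = ≤-reflexive (cong suc (sum-zero _ λ i → cong ⟦_⟧ (𝔹.¬-not λ q → 𝔽.0≢1+n (uniq zero (suc i) eq q))))

-- The labelled vertex set, its degrees and codegrees

module Labelling (D k : ℕ) where

  L K ∣V∣ P β : ℕ
  L = D + k
  K = 2 ^ k
  ∣V∣ = 2 ^ D * (2 ^ L * K)
  P = 2 ^ D * 2 ^ L
  β = 2 ^ L * K

  Vertex : Set
  Vertex = Vec Bool D × Vec Bool L × Vec Bool k

  vertex : Fin ∣V∣ → Vertex
  vertex u = let i , r = remQuot {2 ^ D} (2 ^ L * K) u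
                 j , c = remQuot {2 ^ L} K r in decode D i , decode L j , decode k c

  -- A vertex carries a point `x` as well as a hash seed `C`; adding both hashes makes the label
  -- symmetric and, in characteristic 2, zero on the diagonal. The mask `b` makes each label
  -- attainable whatever the other components are, which gives exact degrees.
  label : Vertex → Vertex → Vec Bool k
  label (x , C , b) (x′ , C′ , b′) = hash k x′ C ⊕ hash k x C′ ⊕ (b ⊕ b′)

  ℓ : Fin ∣V∣ → Fin ∣V∣ → Fin K
  ℓ u v = encode (label (vertex u) (vertex v))

  label-sym : ∀ u v → label u v ≡ label v u
  label-sym (x , C , b) (x′ , C′ , b′) = cong₂ _⊕_ (⊕-comm (hash k x′ C) (hash k x C′)) (⊕-comm b b′)

  label-diag : ∀ u → label u u ≡ replicate k false
  label-diag (x , C , b) = trans (cong₂ _⊕_ (⊕-self (hash k x C)) (⊕-self b)) (⊕-self (replicate k false))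

  ℓ-sym : ∀ u v → ℓ u v ≡ ℓ v u
  ℓ-sym u v = cong encode (label-sym (vertex u) (vertex v))

  ℓ-diag : ∀ u → toℕ (ℓ u u) ≡ 0
  ℓ-diag u = trans (cong (toℕ ∘ encode) (label-diag (vertex u))) (toℕ-encode-zero k)

  sum-vertex : (f : Vertex → ℕ) → sum (λ u → f (vertex u)) ≡
    sumᵇ D (λ x → sumᵇ L (λ C → sumᵇ k (λ b → f (x , C , b))))
  sum-vertex f = begin
    sum (λ u → f (vertex u))
      ≡⟨ sum-combine (2 ^ D) (2 ^ L * K) (λ u → f (vertex u)) ⟩
    sum {2 ^ D} (λ i → sum {2 ^ L * K} (λ r → f (vertex (combine i r))))
      ≡⟨ sum-cong-≗ {2 ^ D} (λ i → sum-cong-≗ {2 ^ L * K} (λ r →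
           cong (λ (i , r) → f (decode D i , rest r)) (𝔽.remQuot-combine {2 ^ D} {2 ^ L * K} i r))) ⟩
    sum {2 ^ D} (λ i → sum {2 ^ L * K} (λ r → f (decode D i , rest r)))
      ≡⟨ sum-cong-≗ {2 ^ D} (λ i → sum-combine (2 ^ L) K (λ r → f (decode D i , rest r))) ⟩
    sum {2 ^ D} (λ i → sum {2 ^ L} (λ j → sum {K} (λ c → f (decode D i , rest (combine j c)))))
      ≡⟨ sum-cong-≗ {2 ^ D} (λ i → sum-cong-≗ {2 ^ L} (λ j → sum-cong-≗ {K} (λ c →
           cong (λ (j , c) → f (decode D i , decode L j , decode k c)) (𝔽.remQuot-combine {2 ^ L} {K} j c)))) ⟩
    sumᵇ D (λ x → sumᵇ L (λ C → sumᵇ k (λ b → f (x , C , b)))) ∎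
    where
    open ≡-Reasoning
    rest : Fin (2 ^ L * K) → Vec Bool L × Vec Bool k
    rest r = let j , c = remQuot {2 ^ L} K r in decode L j , decode k c

  ∣V∣≡P*K : ∣V∣ ≡ P * K
  ∣V∣≡P*K = sym (*-assoc (2 ^ D) (2 ^ L) K)

  open PseudoRandom ℓ

  ⊕-cancel : ∀ {t} (h b b′ : Vec Bool t) → h ⊕ ((h ⊕ b′ ⊕ b) ⊕ b′) ≡ b
  ⊕-cancel []      []      []        = refl
  ⊕-cancel (h ∷ v) (b ∷ w) (b′ ∷ w′) = cong₂ _∷_
    (solve 3 (λ h b b′ → h :+ (((h :+ b′) :+ b) :+ b′) := b) refl h b b′) (⊕-cancel v w w′)
    where open xor-∧-Solver

  ⊕-injectiveʳ : ∀ {t} (h b′ b c : Vec Bool t) → h ⊕ (b ⊕ b′) ≡ h ⊕ (c ⊕ b′) → b ≡ c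
  ⊕-injectiveʳ h b′ b c p = ⊕≡0⇒≡ b c (trans (identity h b′ b c)
    (trans (cong (_⊕ (h ⊕ (c ⊕ b′))) p) (⊕-self _)))
    where
    identity : ∀ {t} (h b′ b c : Vec Bool t) → b ⊕ c ≡ (h ⊕ (b ⊕ b′)) ⊕ (h ⊕ (c ⊕ b′))
    identity []      []        []      []      = refl
    identity (h ∷ v) (b′ ∷ w′) (b ∷ w) (c ∷ y) = cong₂ _∷_
      (solve 4 (λ h b′ b c → b :+ c := (h :+ (b :+ b′)) :+ (h :+ (c :+ b′))) refl h b′ b c) (identity v w′ w y)
      where open xor-∧-Solver

  ⊕-transfer : ∀ {t} (h₁ h₂ q₁ q₂ b b₁ b₂ : Vec Bool t) →
    h₁ ⊕ q₁ ⊕ (b ⊕ b₁) ≡ h₂ ⊕ q₂ ⊕ (b ⊕ b₂) → h₁ ⊕ h₂ ≡ q₁ ⊕ q₂ ⊕ (b₁ ⊕ b₂)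
  ⊕-transfer h₁ h₂ q₁ q₂ b b₁ b₂ p = ⊕≡0⇒≡ _ _ (trans (identity h₁ h₂ q₁ q₂ b b₁ b₂)
    (trans (cong (_⊕ (h₂ ⊕ q₂ ⊕ (b ⊕ b₂))) p) (⊕-self _)))
    where
    identity : ∀ {t} (h₁ h₂ q₁ q₂ b b₁ b₂ : Vec Bool t) →
      (h₁ ⊕ h₂) ⊕ (q₁ ⊕ q₂ ⊕ (b₁ ⊕ b₂)) ≡ (h₁ ⊕ q₁ ⊕ (b ⊕ b₁)) ⊕ (h₂ ⊕ q₂ ⊕ (b ⊕ b₂))
    identity [] [] [] [] [] [] [] = refl
    identity (h₁ ∷ v₁) (h₂ ∷ v₂) (q₁ ∷ w₁) (q₂ ∷ w₂) (b ∷ y) (b₁ ∷ y₁) (b₂ ∷ y₂) = cong₂ _∷_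
      (solve 7 (λ h₁ h₂ q₁ q₂ b b₁ b₂ → (h₁ :+ h₂) :+ ((q₁ :+ q₂) :+ (b₁ :+ b₂)) :=
        ((h₁ :+ q₁) :+ (b :+ b₁)) :+ ((h₂ :+ q₂) :+ (b :+ b₂))) refl h₁ h₂ q₁ q₂ b b₁ b₂)
      (identity v₁ v₂ w₁ w₂ y y₁ y₂)
      where open xor-∧-Solver

  test : Fin K → Fin ∣V∣ → Vertex → Bool
  test c v w = label w (vertex v) ≡ᵛ decode k c

  has≡test : ∀ c u v → has c u v ≡ test c v (vertex u)
  has≡test c u v = ⇔→≡ {has c u v} {test c v (vertex u)}
    (λ p → ⇒≡ᵛ _ _ (trans (sym (decode-encode (label (vertex u) (vertex v)))) (cong (decode k) (has⇒≡ u v p))))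
    (λ p → ≡⇒has u v (trans (cong encode (≡ᵛ⇒≡ (label (vertex u) (vertex v)) (decode k c) p)) (encode-decode k c)))
    where
    ⇔→≡ : ∀ {a b} → (a ≡ true → b ≡ true) → (b ≡ true → a ≡ true) → a ≡ b
    ⇔→≡ {true}          f g = sym (f refl)
    ⇔→≡ {false} {true}  f g = g refl
    ⇔→≡ {false} {false} f g = refl

  degree : ∀ c v → P ≤ # (λ u → has c u v)
  degree c v = begin
    2 ^ D * 2 ^ L
      ≡⟨ cong (2 ^ D *_) (*-identityʳ (2 ^ L)) ⟨
    2 ^ D * (2 ^ L * 1)
      ≤⟨ sum-const≥ {2 ^ D} _ (2 ^ L * 1) (λ i → sum-const≥ {2 ^ L} _ 1 (λ j → solvable (decode D i) (decode L j))) ⟩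
    sumᵇ D (λ x → sumᵇ L (λ C → sumᵇ k (λ b → ⟦ test c v (x , C , b) ⟧)))
      ≡⟨ sum-vertex (λ w → ⟦ test c v w ⟧) ⟨
    sum (λ u → ⟦ test c v (vertex u) ⟧)
      ≡⟨ sum-cong-≗ (λ u → cong ⟦_⟧ (has≡test c u v)) ⟨
    sum (λ u → ⟦ has c u v ⟧)
      ≡⟨ #-sum _ ⟨
    # (λ u → has c u v) ∎
    where
    open ≤-Reasoning
    solvable : ∀ x C → 1 ≤ sumᵇ k (λ b → ⟦ test c v (x , C , b) ⟧)
    solvable x C = ≤-trans (≤-reflexive (cong ⟦_⟧ (sym hit)))
      (term≤sum (λ i → ⟦ test c v (x , C , decode k i) ⟧) (encode b₀))
      where
      x′ = proj₁ (vertex v)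
      C′ = proj₁ (proj₂ (vertex v))
      b′ = proj₂ (proj₂ (vertex v))
      h = hash k x′ C ⊕ hash k x C′
      b₀ = h ⊕ b′ ⊕ decode k c
      hit : test c v (x , C , decode k (encode b₀)) ≡ true
      hit = ⇒≡ᵛ _ _ (trans (cong (λ b → h ⊕ (b ⊕ b′)) (decode-encode b₀)) (⊕-cancel h (decode k c) b′))

  -- Vertices with equal points give equal hashes of any common seed, so their two label conditions
  -- are not independent.
  same : Fin ∣V∣ → Fin ∣V∣ → Bool
  same v v′ = proj₁ (vertex v) ≡ᵛ proj₁ (vertex v′)

  same-few : ∀ v → # (same v) ≤ β
  same-few v = begin
    # (same v)
      ≡⟨ #-sum (same v) ⟩
    sum (λ v′ → ⟦ same v v′ ⟧)
      ≡⟨ sum-vertex (λ (x′ , _) → ⟦ x ≡ᵛ x′ ⟧) ⟩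
    sumᵇ D (λ x′ → sumᵇ L (λ _ → sumᵇ k (λ _ → ⟦ x ≡ᵛ x′ ⟧)))
      ≤⟨ sum-mono {2 ^ D} _ _ (λ i → sum-const≤ {2 ^ L} _ _ (λ j → sum-const≤ {K} _ _ (λ _ → ≤-refl))) ⟩
    sumᵇ D (λ x′ → 2 ^ L * (K * ⟦ x ≡ᵛ x′ ⟧))
      ≡⟨ sum-cong-≗ {2 ^ D} (λ i → trans (sym (*-assoc (2 ^ L) K _)) (*-comm β ⟦ x ≡ᵛ decode D i ⟧)) ⟩
    sumᵇ D (λ x′ → ⟦ x ≡ᵛ x′ ⟧ * β)
      ≡⟨ *-distribʳ-sum {2 ^ D} β (λ i → ⟦ x ≡ᵛ decode D i ⟧) ⟨
    sumᵇ D (λ x′ → ⟦ x ≡ᵛ x′ ⟧) * β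
      ≤⟨ *-monoˡ-≤ β (unique≤1 {2 ^ D} (λ i → x ≡ᵛ decode D i)
           (λ i j p q → decode-injective D (trans (sym (≡ᵛ⇒≡ x (decode D i) p)) (≡ᵛ⇒≡ x (decode D j) q)))) ⟩
    1 * β
      ≡⟨ *-identityˡ β ⟩
    β ∎
    where
    open ≤-Reasoning
    x = proj₁ (vertex v)

  module _ (c : Fin K) (v v′ : Fin ∣V∣) where

    common : Vertex → Bool
    common w = test c v w ∧ test c v′ w

    codegree-sum : # (λ u → has c u v ∧ has c u v′) ≡ sumᵇ D (λ x → sumᵇ L (λ C → sumᵇ k (λ b → ⟦ common (x , C , b) ⟧)))
    codegree-sum = trans (#-sum _) (trans
      (sum-cong-≗ (λ u → cong ⟦_⟧ (cong₂ _∧_ (has≡test c u v) (has≡test c u v′))))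
      (sum-vertex (λ w → ⟦ common w ⟧)))

    x₁ = proj₁ (vertex v)
    C₁ = proj₁ (proj₂ (vertex v))
    b₁ = proj₂ (proj₂ (vertex v))
    x₂ = proj₁ (vertex v′)
    C₂ = proj₁ (proj₂ (vertex v′))
    b₂ = proj₂ (proj₂ (vertex v′))

    inner≤1 : ∀ x C → sumᵇ k (λ b → ⟦ common (x , C , b) ⟧) ≤ 1
    inner≤1 x C = unique≤1 {K} (λ i → common (x , C , decode k i)) (λ i j p q → decode-injective k
      (⊕-injectiveʳ (hash k x₁ C ⊕ hash k x C₁) b₁ _ _
        (trans (≡ᵛ⇒≡ _ _ (∧-elimˡ p)) (sym (≡ᵛ⇒≡ _ _ (∧-elimˡ q))))))

    target : Vec Bool D → Vec Bool k
    target x = hash k x C₁ ⊕ hash k x C₂ ⊕ (b₁ ⊕ b₂)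

    common⇒ : ∀ x C b → common (x , C , b) ≡ true → hash k (x₁ ⊕ x₂) C ≡ᵛ target x ≡ true
    common⇒ x C b p = ⇒≡ᵛ _ _ (trans (hash-⊕ k x₁ x₂ C)
      (⊕-transfer (hash k x₁ C) (hash k x₂ C) (hash k x C₁) (hash k x C₂) b b₁ b₂
        (trans (≡ᵛ⇒≡ _ _ (∧-elimˡ p)) (sym (≡ᵛ⇒≡ _ _ (∧-elimʳ {test c v (x , C , b)} p))))))

    inner≤ : ∀ x C → sumᵇ k (λ b → ⟦ common (x , C , b) ⟧) ≤ ⟦ hash k (x₁ ⊕ x₂) C ≡ᵛ target x ⟧
    inner≤ x C = go (true? _)
      where
      go : (hash k (x₁ ⊕ x₂) C ≡ᵛ target x ≡ true) ⊎ (hash k (x₁ ⊕ x₂) C ≡ᵛ target x ≡ false) →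
           sumᵇ k (λ b → ⟦ common (x , C , b) ⟧) ≤ ⟦ hash k (x₁ ⊕ x₂) C ≡ᵛ target x ⟧
      go (inj₁ p) = ≤-trans (inner≤1 x C) (≤-reflexive (cong ⟦_⟧ (sym p)))
      go (inj₂ p) = ≤-trans (≤-reflexive (sum-zero {K} _ (λ i → cong ⟦_⟧ (𝔹.¬-not λ q →
        false≢true (trans (sym p) (common⇒ x C (decode k i) q)))))) z≤n

    -- Adding the two label equations cancels the mask `b` of the third vertex and leaves a `k`-bit
    -- condition on its seed, the hash of the nonzero point `x₁ ⊕ x₂`. By uniformity it holds for a
    -- share `1 / K` of the seeds, and then at most one mask fits.
    codegree-distinct : x₁ ≢ x₂ → K * # (λ u → has c u v ∧ has c u v′) ≤ P
    codegree-distinct x₁≢x₂ = begin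
      K * # (λ u → has c u v ∧ has c u v′)
        ≡⟨ cong (K *_) codegree-sum ⟩
      K * sumᵇ D (λ x → sumᵇ L (λ C → sumᵇ k (λ b → ⟦ common (x , C , b) ⟧)))
        ≤⟨ *-monoʳ-≤ K (sum-mono {2 ^ D} _ _ (λ i → sum-mono {2 ^ L} _ _ (λ j → inner≤ (decode D i) (decode L j)))) ⟩
      K * sumᵇ D (λ x → hits k L (x₁ ⊕ x₂) (target x))
        ≡⟨ *-distribˡ-sum {2 ^ D} K (λ i → hits k L (x₁ ⊕ x₂) (target (decode D i))) ⟩
      sumᵇ D (λ x → K * hits k L (x₁ ⊕ x₂) (target x))
        ≤⟨ sum-const≤ {2 ^ D} _ (2 ^ L) (λ i → ≤-reflexive (trans (*-comm K _)
             (hits-uniform k (x₁ ⊕ x₂) (target (decode D i)) (x₁≢x₂ ∘ ⊕≡0⇒≡ x₁ x₂)))) ⟩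
      P ∎
      where open ≤-Reasoning

    codegree-any : K * # (λ u → has c u v ∧ has c u v′) ≤ P * K
    codegree-any = ≤-trans (*-monoʳ-≤ K (begin
      # (λ u → has c u v ∧ has c u v′)
        ≡⟨ codegree-sum ⟩
      sumᵇ D (λ x → sumᵇ L (λ C → sumᵇ k (λ b → ⟦ common (x , C , b) ⟧)))
        ≤⟨ sum-const≤ {2 ^ D} _ (2 ^ L * 1) (λ i → sum-const≤ {2 ^ L} _ 1 (λ j → inner≤1 (decode D i) (decode L j))) ⟩
      2 ^ D * (2 ^ L * 1)
        ≡⟨ cong (2 ^ D *_) (*-identityʳ (2 ^ L)) ⟩
      P ∎)) (≤-reflexive (*-comm K P))
      where open ≤-Reasoning

    codegree : K * # (λ u → has c u v ∧ has c u v′) ≤ P + ⟦ same v v′ ⟧ * (P * K)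
    codegree = go (true? (same v v′))
      where
      go : same v v′ ≡ true ⊎ same v v′ ≡ false → K * # (λ u → has c u v ∧ has c u v′) ≤ P + ⟦ same v v′ ⟧ * (P * K)
      go (inj₁ p) = ≤-trans codegree-any (≤-trans (m≤n+m (P * K) P)
        (≤-reflexive (cong (P +_) (trans (sym (+-identityʳ (P * K))) (cong (λ z → ⟦ z ⟧ * (P * K)) (sym p))))))
      go (inj₂ p) = ≤-trans (codegree-distinct λ q → false≢true (trans (sym p) (⇒≡ᵛ _ _ q))) (m≤m+n P _)

  -- As `β` is `K` times the square root of `∣V∣`, this is `4 K² ∣V∣^(3/2)`.
  Q : ℕ
  Q = 4 * (K * ∣V∣ * β)

  many : MostHaveManyNeighbours Q
  many = Chebyshev.many ℓ P β ∣V∣≡P*K same degree codegree same-few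

  few : MostHaveFewNeighbours Q
  few = Chebyshev.few ℓ P β ∣V∣≡P*K same degree codegree same-few

-- Choice of parameters

n<2^[1+log₂n] : ∀ n → n < 2 ^ suc ⌊log₂ n ⌋
n<2^[1+log₂n] n = ≰⇒> λ p → 1+n≰n (≤-trans (≤-reflexive (sym (⌊log₂[2^n]⌋≡n (suc ⌊log₂ n ⌋)))) (⌊log₂⌋-mono-≤ p))

2^log₂n≤n : ∀ n → 1 ≤ n → 2 ^ ⌊log₂ n ⌋ ≤ n
2^log₂n≤n = <-rec (λ n → 1 ≤ n → 2 ^ ⌊log₂ n ⌋ ≤ n) step
  where
  step : ∀ n → (∀ {m} → m < n → 1 ≤ m → 2 ^ ⌊log₂ m ⌋ ≤ m) → 1 ≤ n → 2 ^ ⌊log₂ n ⌋ ≤ n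
  step 1 _ _ = ≤-refl
  step n@(suc (suc m)) rec _ = begin
    2 ^ ⌊log₂ n ⌋                   ≡⟨ cong (2 ^_) (suc-pred ⌊log₂ n ⌋ ⦃ >-nonZero (⌊log₂⌋-mono-≤ {2} {n} (s≤s (s≤s z≤n))) ⦄) ⟨
    2 * 2 ^ pred ⌊log₂ n ⌋          ≡⟨ cong (λ z → 2 * 2 ^ z) (trans (pred[n]≡n∸1 {⌊log₂ n ⌋}) (sym (⌊log₂⌊n/2⌋⌋≡⌊log₂n⌋∸1 n))) ⟩
    2 * 2 ^ ⌊log₂ ⌊ n /2⌋ ⌋         ≤⟨ *-monoʳ-≤ 2 (rec (⌊n/2⌋<n (suc m)) (s≤s z≤n)) ⟩
    2 * ⌊ n /2⌋                     ≡⟨ cong (⌊ n /2⌋ +_) (+-identityʳ _) ⟩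
    ⌊ n /2⌋ + ⌊ n /2⌋               ≤⟨ +-monoʳ-≤ ⌊ n /2⌋ (⌊n/2⌋≤⌈n/2⌉ n) ⟩
    ⌊ n /2⌋ + ⌈ n /2⌉               ≡⟨ ⌊n/2⌋+⌈n/2⌉≡n n ⟩
    n                               ∎
    where
    open ≤-Reasoning
    pred[n]≡n∸1 : ∀ {n} → pred n ≡ n ∸ 1
    pred[n]≡n∸1 {zero}  = refl
    pred[n]≡n∸1 {suc n} = refl

treeCost+1≡2^ : ∀ h → treeCost h + 1 ≡ 2 ^ h
treeCost+1≡2^ zero    = refl
treeCost+1≡2^ (suc h) = trans (lemma (treeCost h)) (cong (2 *_) (treeCost+1≡2^ h))
  where
  lemma : ∀ c → suc (c + c) + 1 ≡ 2 * (c + 1)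
  lemma = solve-∀

PowerOf2 : ℕ → Set
PowerOf2 a = ∃ λ x → a ≡ 2 ^ x

pow : ∀ x → PowerOf2 (2 ^ x)
pow x = x , refl

infixl 7 _⊗_
_⊗_ : ∀ {a b} → PowerOf2 a → PowerOf2 b → PowerOf2 (a * b)
(x , p) ⊗ (y , q) = x + y , trans (cong₂ _*_ p q) (sym (^-distribˡ-+-* 2 x y))

2^-mono : ∀ {x y} → x ≤ y → 2 ^ x ≤ 2 ^ y
2^-mono = ^-monoʳ-≤ 2

module Parameters (n g : ℕ) (n≤2^g : n ≤ 2 ^ g) (g≥1 : 1 ≤ g) where

  -- `2 ^ k` is `M ^ G`, `2 ^ e′` is `τ G`, and `2 ^ r` is the loss per level of the tree. The
  -- number `d` collects all losses: `ν` for `budget`, `(k + 3) * G` for the blue embedding and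
  -- `g * r` for the tree. With points of `2 * d` bits, there are at least 2^(4d) vertices, and the
  -- square root of `Q` is 2^(3d) up to powers of K, so a loss of 2^d is affordable: `s₀ + g * r`
  -- equals `4 * d`.
  G k e′ e ν r d μ s₀ : ℕ
  G  = 2 ^ g
  k  = (2 * g + 1) * G
  e′ = k + 3 + 4 * G
  e  = g + e′
  ν  = 2 * g + 7 + 6 * k + e′
  r  = 1 + g + e * G
  d  = ν + (k + 3) * G + g * r
  μ  = 3 * d + ν
  s₀ = μ + (k + 3) * G

  open Labelling (2 * d) k public

  M : ℕ
  M = 2 ^ (2 * g + 1)

  τ : ℕ → ℕ
  τ i = 2 ^ (k + 3 + 4 * i)

  logN : ℕ
  logN = 4 * d + 2 * k

  ∣V∣≡2^ : ∣V∣ ≡ 2 ^ logN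
  ∣V∣≡2^ = trans (proj₂ (pow (2 * d) ⊗ (pow L ⊗ pow k))) (cong (2 ^_) (lemma d k))
    where
    lemma : ∀ d k → 2 * d + (2 * d + k + k) ≡ 4 * d + 2 * k
    lemma = solve-∀

  q : ℕ
  q = 6 * d + 5 * k + 2

  Q≡2^ : Q ≡ 2 ^ q
  Q≡2^ = trans (proj₂ (pow 2 ⊗ (pow k ⊗ (logN , ∣V∣≡2^) ⊗ (pow L ⊗ pow k)))) (cong (2 ^_) (lemma d k))
    where
    lemma : ∀ d k → 2 + (k + (4 * d + 2 * k) + (2 * d + k + k)) ≡ 6 * d + 5 * k + 2
    lemma = solve-∀

  8K≡2^ : 8 * K ≡ 2 ^ (3 + k)
  8K≡2^ = proj₂ (pow 3 ⊗ pow k)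

  τ-suc : ∀ i → τ (suc i) ≡ 16 * τ i
  τ-suc i = trans (cong (2 ^_) (lemma k i)) (sym (proj₂ (pow 4 ⊗ pow (k + 3 + 4 * i))))
    where
    lemma : ∀ k i → k + 3 + 4 * suc i ≡ 4 + (k + 3 + 4 * i)
    lemma = solve-∀

  8K≤τ : ∀ i → 8 * K ≤ τ i
  8K≤τ i = ≤-trans (≤-reflexive (trans 8K≡2^ (cong (2 ^_) (+-comm 3 k)))) (2^-mono (m≤m+n (k + 3) (4 * i)))

  τ≤E : ∀ i → i ≤ G → τ i ≤ 2 ^ e′
  τ≤E i p = 2^-mono (+-monoʳ-≤ (k + 3) (*-monoʳ-≤ 4 p))

  e≡ : 2 ^ e ≡ G * 2 ^ e′
  e≡ = ^-distribˡ-+-* 2 g e′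

  2K≤ : 2 * K ≤ 2 ^ e
  2K≤ = ≤-trans (2^-mono {1 + k} {e′} (≤-trans (≤-trans (≤-reflexive (+-comm 1 k)) (+-monoʳ-≤ k (s≤s z≤n))) (m≤m+n (k + 3) (4 * G))))
                (2^-mono (m≤n+m e′ g))

  M≥ : n * n + 3 ≤ M
  M≥ = begin
    n * n + 3                      ≤⟨ +-mono-≤ (*-mono-≤ n≤2^g n≤2^g) (≤-trans (n≤1+n 3) (2^-mono {2} (*-monoʳ-≤ 2 g≥1))) ⟩
    G * G + 2 ^ (2 * g)            ≡⟨ cong (_+ 2 ^ (2 * g)) (trans (proj₂ (pow g ⊗ pow g)) (cong (2 ^_) (double g))) ⟩
    2 ^ (2 * g) + 2 ^ (2 * g)      ≡⟨ cong (2 ^ (2 * g) +_) (+-identityʳ (2 ^ (2 * g))) ⟨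
    2 ^ suc (2 * g)                ≡⟨ cong (2 ^_) (+-comm 1 (2 * g)) ⟩
    M                              ∎
    where
    open ≤-Reasoning
    double : ∀ g → g + g ≡ 2 * g
    double = solve-∀

  K≥ : M ^ (treeCost g + 1) ≤ K
  K≥ = ≤-reflexive (trans (cong (M ^_) (treeCost+1≡2^ g)) (^-*-assoc 2 (2 * g + 1) G))

  ω≤ : 2 ^ μ * (8 * K) ^ n ≤ 2 ^ s₀
  ω≤ = begin
    2 ^ μ * (8 * K) ^ n            ≡⟨ cong (λ z → 2 ^ μ * z ^ n) 8K≡2^ ⟩
    2 ^ μ * (2 ^ (3 + k)) ^ n      ≡⟨ cong (2 ^ μ *_) (^-*-assoc 2 (3 + k) n) ⟩
    2 ^ μ * 2 ^ ((3 + k) * n)      ≤⟨ *-monoʳ-≤ (2 ^ μ) (2^-mono (*-mono-≤ (≤-reflexive (+-comm 3 k)) n≤2^g)) ⟩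
    2 ^ μ * 2 ^ ((k + 3) * G)      ≡⟨ ^-distribˡ-+-* 2 μ _ ⟨
    2 ^ s₀                         ∎
    where open ≤-Reasoning

  -- `ν` is the exponent of everything on the left beyond the 2^(6d) inside `Q`, plus one for
  -- strictness; the square on the right supplies it twice.
  budget : G * (Q + 8 * K * (G * (2 ^ e′ * Q))) < 2 ^ μ * 2 ^ μ
  budget = begin-strict
    G * (Q + X)                    ≤⟨ *-monoʳ-≤ G (+-monoˡ-≤ X Q≤X) ⟩
    G * (X + X)                    ≡⟨ cong (λ z → G * (X + z)) (+-identityʳ X) ⟨
    G * (2 * X)                    ≡⟨ proj₂ (pow g ⊗ (pow 1 ⊗ (x , X≡2^))) ⟩
    2 ^ (g + (1 + x))              <⟨ ^-monoʳ-< 2 (s≤s (s≤s z≤n)) (n<1+n (g + (1 + x))) ⟩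
    2 ^ suc (g + (1 + x))          ≤⟨ 2^-mono (≤-trans (m≤m+n (suc (g + (1 + x))) ν) (≤-reflexive (lemma d g k e′))) ⟩
    2 ^ (μ + μ)                    ≡⟨ ^-distribˡ-+-* 2 μ μ ⟩
    2 ^ μ * 2 ^ μ                  ∎
    where
    open ≤-Reasoning
    X x : ℕ
    X = 8 * K * (G * (2 ^ e′ * Q))
    x = 3 + k + (g + (e′ + q))
    X≡2^ : X ≡ 2 ^ x
    X≡2^ = proj₂ ((3 + k , 8K≡2^) ⊗ (pow g ⊗ (pow e′ ⊗ (q , Q≡2^))))
    Q≤X : Q ≤ X
    Q≤X = ≤-trans (≤-reflexive Q≡2^) (≤-trans (2^-mono (≤-trans (m≤n+m q e′) (≤-trans (m≤n+m _ g) (m≤n+m _ (3 + k))))) (≤-reflexive (sym X≡2^)))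
    lemma : ∀ d g k e →
      suc (g + (1 + (3 + k + (g + (e + (6 * d + 5 * k + 2)))))) + (2 * g + 7 + 6 * k + e) ≡
      3 * d + (2 * g + 7 + 6 * k + e) + (3 * d + (2 * g + 7 + 6 * k + e))
    lemma = solve-∀

  S₀-big : G * Q < 2 ^ s₀ * 2 ^ s₀
  S₀-big = ≤-<-trans (*-monoʳ-≤ G (m≤m+n Q _)) (<-≤-trans budget (*-mono-≤ μ≤s₀ μ≤s₀))
    where
    μ≤s₀ : 2 ^ μ ≤ 2 ^ s₀
    μ≤s₀ = 2^-mono (m≤m+n μ _)

  module _ (H : EOGraph n) where

    open Ramsey ⦃ m^n≢0 2 k ⦄ H ℓ ℓ-sym ℓ-diag Q many few g e (2 ^ e′) M (2 ^ s₀) (2 ^ μ) ⦃ m^n≢0 2 e′ ⦄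
      τ τ-suc 8K≤τ τ≤E n≤2^g e≡ 2K≤ M≥ K≥ S₀-big ω≤ budget using (S; copy)

    S≤ : ∀ h → S h ≤ 2 ^ (s₀ + h * r)
    S≤ zero    = 2^-mono (m≤m+n s₀ 0)
    S≤ (suc h) = begin
      2 * G * S h * 2 ^ (e * n)                     ≤⟨ *-mono-≤ (*-monoʳ-≤ (2 * G) (S≤ h)) (2^-mono (*-monoʳ-≤ e n≤2^g)) ⟩
      2 * G * 2 ^ (s₀ + h * r) * 2 ^ (e * G)
        ≡⟨ proj₂ (pow 1 ⊗ pow g ⊗ pow (s₀ + h * r) ⊗ pow (e * G)) ⟩
      2 ^ (1 + g + (s₀ + h * r) + e * G)            ≡⟨ cong (2 ^_) (lemma g s₀ h (e * G)) ⟩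
      2 ^ (s₀ + suc h * r)                          ∎
      where
      open ≤-Reasoning
      lemma : ∀ g s h x → 1 + g + (s + h * (1 + g + x)) + x ≡ s + suc h * (1 + g + x)
      lemma = solve-∀

    arrows : Arrows (LabelledGraph.graph ℓ ℓ-sym ℓ-diag) H
    arrows χ = copy χ (≤-trans (S≤ g) (≤-trans (2^-mono fits) (≤-reflexive (sym ∣V∣≡2^))))
      where
      fits : s₀ + g * r ≤ logN
      fits = ≤-trans (≤-reflexive (lemma d ν ((k + 3) * G) (g * r))) (≤-trans (≤-reflexive (four d)) (m≤m+n (4 * d) (2 * k)))
        where
        lemma : ∀ d ν a b → 3 * d + ν + a + b ≡ 3 * d + (ν + a + b)
        lemma = solve-∀
        four : ∀ d → 3 * d + d ≡ 4 * d
        four = solve-∀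

  -- `logN` is a polynomial of degree at most 2 in `g` and in `G`. Every monomial is padded with
  -- ones to four factors and bounded by `g * g * (G * G)`; 230 is the sum of the coefficients.
  logN≤ : logN ≤ 230 * (g * g * (G * G))
  logN≤ = begin
    logN                 ≡⟨ expand g G ⟩
    8 * (g * g * (G * G)) + 28 * (1 * g * (G * G)) + 4 * (1 * 1 * (G * G)) + 4 * (g * g * (1 * G)) + 72 * (1 * g * (1 * G))
      + 58 * (1 * 1 * (1 * G)) + 4 * (g * g * (1 * 1)) + 12 * (1 * g * (1 * 1)) + 40 * (1 * 1 * (1 * 1))
      ≤⟨ +-mono-≤ (+-mono-≤ (+-mono-≤ (+-mono-≤ (+-mono-≤ (+-mono-≤ (+-mono-≤ (+-mono-≤
           (≤-refl {8 * y}) (bound 28 g≥1 ≤-refl G≥1′ ≤-refl)) (bound 4 g≥1 g≥1 G≥1′ ≤-refl)) (bound 4 ≤-refl ≤-refl G≥1 ≤-refl))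
           (bound 72 g≥1 ≤-refl G≥1 ≤-refl)) (bound 58 g≥1 g≥1 G≥1 ≤-refl)) (bound 4 ≤-refl ≤-refl G≥1 G≥1))
           (bound 12 g≥1 ≤-refl G≥1 G≥1)) (bound 40 g≥1 g≥1 G≥1 G≥1) ⟩
    8 * y + 28 * y + 4 * y + 4 * y + 72 * y + 58 * y + 4 * y + 12 * y + 40 * y ≡⟨ collect y ⟩
    230 * y              ∎
    where
    open ≤-Reasoning
    y : ℕ
    y = g * g * (G * G)
    G≥1 : 1 ≤ G
    G≥1 = m^n>0 2 g
    G≥1′ : G ≤ G
    G≥1′ = ≤-refl
    bound : ∀ c {a b x z} → a ≤ g → b ≤ g → x ≤ G → z ≤ G → c * (a * b * (x * z)) ≤ c * y
    bound c p q s t = *-monoʳ-≤ c (*-mono-≤ (*-mono-≤ p q) (*-mono-≤ s t))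
    collect : ∀ y → 8 * y + 28 * y + 4 * y + 4 * y + 72 * y + 58 * y + 4 * y + 12 * y + 40 * y ≡ 230 * y
    collect = solve-∀
    expand : ∀ g G →
      4 * ((2 * g + 7 + 6 * ((2 * g + 1) * G) + ((2 * g + 1) * G + 3 + 4 * G)) + ((2 * g + 1) * G + 3) * G
           + g * (1 + g + (g + ((2 * g + 1) * G + 3 + 4 * G)) * G)) + 2 * ((2 * g + 1) * G) ≡
      8 * (g * g * (G * G)) + 28 * (1 * g * (G * G)) + 4 * (1 * 1 * (G * G)) + 4 * (g * g * (1 * G)) + 72 * (1 * g * (1 * G))
      + 58 * (1 * 1 * (1 * G)) + 4 * (g * g * (1 * 1)) + 12 * (1 * g * (1 * 1)) + 40 * (1 * 1 * (1 * 1))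
    expand = solve-∀

theorem9 : Σ ℕ λ C → 0 < C ×
    (∀ (n : ℕ) → 2 ≤ n → (H : EOGraph n) →
    EdgeIndRamseyLE H (2 ^ (C * (n ^ 2) * (⌊log₂ n ⌋ ^ 2))))
theorem9 = 3680 , s≤s z≤n , bound
  where
  bound : ∀ n → 2 ≤ n → (H : EOGraph n) → EdgeIndRamseyLE H (2 ^ (3680 * (n ^ 2) * (⌊log₂ n ⌋ ^ 2)))
  bound n 2≤n H = ∣V∣ , ≤-trans (≤-reflexive ∣V∣≡2^) (2^-mono exponent) , LabelledGraph.graph ℓ ℓ-sym ℓ-diag , arrows H
    where
    λ₂ g : ℕ
    λ₂ = ⌊log₂ n ⌋
    g  = suc λ₂
    open Parameters n g (<⇒≤ (n<2^[1+log₂n] n)) (s≤s z≤n)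
    g≤ : g ≤ 2 * λ₂
    g≤ = ≤-trans (+-monoˡ-≤ λ₂ (⌊log₂⌋-mono-≤ {2} 2≤n)) (≤-reflexive (cong (λ₂ +_) (sym (+-identityʳ λ₂))))
    G≤ : G ≤ 2 * n
    G≤ = *-monoʳ-≤ 2 (2^log₂n≤n n (≤-trans (s≤s z≤n) 2≤n))
    exponent : logN ≤ 3680 * (n ^ 2) * (λ₂ ^ 2)
    -- `g` is at most twice the logarithm, as `n ≥ 2`, and `G` is at most `2 * n`; their squares
    -- contribute 16, and 230 * 16 = 3680.
    exponent = begin
      logN                                                   ≤⟨ logN≤ ⟩
      230 * (g * g * (G * G))                                ≤⟨ *-monoʳ-≤ 230 (*-mono-≤ (*-mono-≤ g≤ g≤) (*-mono-≤ G≤ G≤)) ⟩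
      230 * (2 * λ₂ * (2 * λ₂) * (2 * n * (2 * n)))          ≡⟨ lemma λ₂ n ⟩
      3680 * (n ^ 2) * (λ₂ ^ 2)                              ∎
      where
      open ≤-Reasoning
      lemma : ∀ l n → 230 * (2 * l * (2 * l) * (2 * n * (2 * n))) ≡ 3680 * (n * (n * 1)) * (l * (l * 1))
      lemma = solve-∀
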